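{- Let $M \models \mathbf{PA}^-$ and $n \geq 0$. The following are equivalent: 1. For every $N \models \mathbf{PA}^-$, if $M \prec N$, then $\sup_N(M) \prec_{\Sigma_{n+1}} N$. 2. $M \models \mathbf{Coll}_{\mathrm{s}}(\Sigma_{n+1})$. 3. (Case $n \geq 1$) $M \models \mathbf{Coll}(\Sigma_n)$ and for every $N \models \mathbf{PA}^- + \mathbf{Coll}(\Sigma_n)$, if $M \prec_{\Sigma_{n+1}} N$, then $\sup_N(M) \prec_{\Sigma_{n+1}} N$. (Case $n = 0$) For every $N \models \mathbf{PA}^-$, if $M \prec_{\Sigma_1} N$, then $\sup_N(M) \prec_{\Sigma_1} N$. 4. For every $N \models \mathbf{PA}^-$, if $M \prec_{\Sigma_{n+2}} N$, then $\sup_N(M) \prec_{\Sigma_{n+1}} N$.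
   Context: $\mathcal{L}_A=\{0,1,+,\times,<\}$ is the language of first-order arithmetic, and $\mathbf{PA}^-$ is the $\mathcal{L}_A$-theory of the non-negative parts of commutative discretely ordered rings. $\Delta_0=\Sigma_0=\Pi_0$ is the class of $\mathcal{L}_A$-formulas all of whose quantifiers are bounded; $\Sigma_{n+1}$ (resp. $\Pi_{n+1}$) formulas are those of the form $\exists \vec{y}\,\varphi$ with $\varphi\in\Pi_n$ (resp. $\forall \vec{y}\,\varphi$ with $\varphi\in\Sigma_n$), where $\vec{y}$ is a finite, possibly empty, tuple. Vector notation denotes finite (possibly empty) tuples of variables or elements; for tuples of the same length, $\vec{x}<\vec{u}$ means $x_i<u_i$ for every $i$. $M\subseteq N$ means $M$ is a substructure of $N$; $M\prec N$ means $N$ is an elementary extension of $M$; $M\prec_\Gamma N$ means $M\subseteq N$ and for every $\vec{a}\in M$ and every $\varphi(\vec{x})\in\Gamma$, $M\models\varphi(\vec{a})$ iff $N\models\varphi(\vec{a})$. For $M,N\models\mathbf{PA}^-$ with $M\subseteq N$, $\sup_N(M):=\{a\in N\mid \exists b\in M\ (N\models a\leq b)\}$, regarded as a substructure of $N$ (it is again a model of $\mathbf{PA}^-$). $\mathbf{Coll}(\Gamma)$ is the scheme $\forall \vec{z}\,\forall \vec{u}\,(\forall \vec{x}<\vec{u}\,\exists \vec{y}\,\varphi(\vec{x},\vec{y},\vec{z})\to\exists \vec{v}\,\forall \vec{x}<\vec{u}\,\exists \vec{y}<\vec{v}\,\varphi(\vec{x},\vec{y},\vec{z}))$ for $\varphi\in\Gamma$.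 $\mathbf{Coll}_{\mathrm{s}}(\Gamma)$ is the scheme $\forall \vec{z}\,\forall \vec{u}\,\exists \vec{v}\,\forall \vec{x}<\vec{u}\,(\exists \vec{y}\,\varphi(\vec{x},\vec{y},\vec{z})\to\exists \vec{y}<\vec{v}\,\varphi(\vec{x},\vec{y},\vec{z}))$ for $\varphi\in\Gamma$. -}

module Defs where

open import Algebra.Bundles using (CommutativeRing)
import Algebra.Properties.Ring as RingProperties
open import Data.Empty using (⊥)
open import Data.Fin.Base using (Fin; zero; suc; _↑ˡ_; _↑ʳ_; lift)
open import Data.Nat.Base using (ℕ; zero; suc)
import Data.Nat.Base as ℕ
open import Data.Product using (Σ; Σ-syntax; ∃-syntax; _×_; _,_; proj₁; proj₂)
open import Data.Sum using (_⊎_; inj₁; inj₂)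
open import Data.Unit using (⊤)
open import Data.Vec.Base using (Vec; []; _∷_; lookup; map)
open import Function.Bundles using (_⇔_)
open import Level using (Level; Lift) renaming (suc to lsuc)
open import Relation.Binary.Core using (Rel)
open import Relation.Binary.PropositionalEquality using (_≡_)
open import Relation.Binary.Structures using (IsEquivalence; IsStrictTotalOrder)
open import Relation.Nullary using (¬_)

infix  10 `_
infixl 9 _⊗_
infixl 8 _⊕_
infix  7 _≐_ _≺_ _≼_
infixr 6 _∧_
infixr 5 _∨_
infixr 4 _⇒_

-- Terms and formulas of the language {0, 1, +, ×, <} with free variables
-- among k de Bruijn indices; index 0 is the innermost bound variable.

data Term (k : ℕ) : Set where
  `_  : Fin k → Term k
  𝟎 𝟏 : Term k
  _⊕_ : Term k → Term k → Term k
  _⊗_ : Term k → Term k → Term k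

data Formula (k : ℕ) : Set where
  _≐_ _≺_     : Term k → Term k → Formula k
  ⊥′          : Formula k
  _∧_ _∨_ _⇒_ : Formula k → Formula k → Formula k
  ∀′ ∃′       : Formula (suc k) → Formula k

Sentence : Set
Sentence = Formula 0

_≼_ : ∀ {k} → Term k → Term k → Formula k
s ≼ t = (s ≺ t) ∨ (s ≐ t)

renameᵗ : ∀ {k l} → (Fin k → Fin l) → Term k → Term l
renameᵗ r (` i)   = ` r i
renameᵗ r 𝟎       = 𝟎
renameᵗ r 𝟏       = 𝟏
renameᵗ r (s ⊕ t) = renameᵗ r s ⊕ renameᵗ r t
renameᵗ r (s ⊗ t) = renameᵗ r s ⊗ renameᵗ r t

rename : ∀ {k l} → (Fin k → Fin l) → Formula k → Formula l
rename r (s ≐ t) = renameᵗ r s ≐ renameᵗ r t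
rename r (s ≺ t) = renameᵗ r s ≺ renameᵗ r t
rename r ⊥′      = ⊥′
rename r (φ ∧ ψ) = rename r φ ∧ rename r ψ
rename r (φ ∨ ψ) = rename r φ ∨ rename r ψ
rename r (φ ⇒ ψ) = rename r φ ⇒ rename r ψ
rename r (∀′ φ)  = ∀′ (rename (lift 1 r) φ)
rename r (∃′ φ)  = ∃′ (rename (lift 1 r) φ)

-- Quantification over a tuple of m variables. The tuple occupies the first m
-- indices of the body: a body over m + k variables is read as φ(y⃗ , ρ).

∀* : ∀ m {k} → Formula (m ℕ.+ k) → Formula k
∀* zero    φ = φ
∀* (suc m) φ = ∀* m (∀′ φ)

∃* : ∀ m {k} → Formula (m ℕ.+ k) → Formula k
∃* zero    φ = φ
∃* (suc m) φ = ∃* m (∃′ φ)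

closure : ∀ {k} → Formula k → Sentence
closure {zero}  φ = φ
closure {suc k} φ = closure (∀′ φ)

⋀ : ∀ {m k} → (Fin m → Formula k) → Formula k
⋀ {zero}  φ = ⊥′ ⇒ ⊥′
⋀ {suc m} φ = φ zero ∧ ⋀ (λ i → φ (suc i))

-- ∀ x⃗ < b⃗ and ∃ x⃗ < b⃗, where the bounds b⃗ are variables of the outer context.

below : ∀ {m k} → (Fin m → Fin k) → Formula (m ℕ.+ k)
below {m} {k} b = ⋀ (λ i → (` (i ↑ˡ k)) ≺ (` (m ↑ʳ b i)))

∀<* : ∀ {m k} → (Fin m → Fin k) → Formula (m ℕ.+ k) → Formula k
∀<* {m} b φ = ∀* m (below b ⇒ φ)

∃<* : ∀ {m k} → (Fin m → Fin k) → Formula (m ℕ.+ k) → Formula k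
∃<* {m} b φ = ∃* m (below b ∧ φ)

FormulaClass : Set₁
FormulaClass = ∀ {k} → Formula k → Set

-- The bound of a bounded quantifier is any term not containing the quantified
-- variable.

data Δ₀ : FormulaClass where
  _≐_ : ∀ {k} (s t : Term k) → Δ₀ (s ≐ t)
  _≺_ : ∀ {k} (s t : Term k) → Δ₀ (s ≺ t)
  ⊥′  : ∀ {k} → Δ₀ {k} ⊥′
  _∧_ : ∀ {k} {φ ψ : Formula k} → Δ₀ φ → Δ₀ ψ → Δ₀ (φ ∧ ψ)
  _∨_ : ∀ {k} {φ ψ : Formula k} → Δ₀ φ → Δ₀ ψ → Δ₀ (φ ∨ ψ)
  _⇒_ : ∀ {k} {φ ψ : Formula k} → Δ₀ φ → Δ₀ ψ → Δ₀ (φ ⇒ ψ)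
  ∀<  : ∀ {k} (t : Term k) {φ : Formula (suc k)} →
        Δ₀ φ → Δ₀ (∀′ ((` zero) ≺ renameᵗ suc t ⇒ φ))
  ∃<  : ∀ {k} (t : Term k) {φ : Formula (suc k)} →
        Δ₀ φ → Δ₀ (∃′ ((` zero) ≺ renameᵗ suc t ∧ φ))

mutual
  Σₙ : ℕ → FormulaClass
  Σₙ zero    φ     = Δ₀ φ
  Σₙ (suc n) {k} φ = ∃[ m ] Σ[ ψ ∈ Formula (m ℕ.+ k) ] (Πₙ n ψ × φ ≡ ∃* m ψ)

  Πₙ : ℕ → FormulaClass
  Πₙ zero    φ     = Δ₀ φ
  Πₙ (suc n) {k} φ = ∃[ m ] Σ[ ψ ∈ Formula (m ℕ.+ k) ] (Σₙ n ψ × φ ≡ ∀* m ψ)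

AllFormulas : FormulaClass
AllFormulas _ = ⊤

-- Structures are setoid-based: ≈ interprets equality, and the operations and
-- the relation respect it. Quotients are thereby not needed.

record Structure (ℓ : Level) : Set (lsuc ℓ) where
  infix  4 _≈_ _<_ _≤_
  infixl 6 _+_
  infixl 7 _*_
  field
    Carrier       : Set ℓ
    _≈_           : Rel Carrier ℓ
    isEquivalence : IsEquivalence _≈_
    0# 1#         : Carrier
    _+_ _*_       : Carrier → Carrier → Carrier
    _<_           : Rel Carrier ℓ
    +-cong        : ∀ {x x′ y y′} → x ≈ x′ → y ≈ y′ → x + y ≈ x′ + y′
    *-cong        : ∀ {x x′ y y′} → x ≈ x′ → y ≈ y′ → x * y ≈ x′ * y′
    <-cong        : ∀ {x x′ y y′} → x ≈ x′ → y ≈ y′ → x < y → x′ < y′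

  open IsEquivalence isEquivalence public

  _≤_ : Rel Carrier ℓ
  x ≤ y = x < y ⊎ x ≈ y

module _ {ℓ : Level} (M : Structure ℓ) where
  open Structure M

  ⟦_⟧ : ∀ {k} → Term k → Vec Carrier k → Carrier
  ⟦ ` i ⟧   ρ = lookup ρ i
  ⟦ 𝟎 ⟧     ρ = 0#
  ⟦ 𝟏 ⟧     ρ = 1#
  ⟦ s ⊕ t ⟧ ρ = ⟦ s ⟧ ρ + ⟦ t ⟧ ρ
  ⟦ s ⊗ t ⟧ ρ = ⟦ s ⟧ ρ * ⟦ t ⟧ ρ

  infix 3 _⊨_[_]
  _⊨_[_] : ∀ {k} → Formula k → Vec Carrier k → Set ℓ
  _⊨_[_] (s ≐ t) ρ = ⟦ s ⟧ ρ ≈ ⟦ t ⟧ ρ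
  _⊨_[_] (s ≺ t) ρ = ⟦ s ⟧ ρ < ⟦ t ⟧ ρ
  _⊨_[_] ⊥′      ρ = Lift ℓ ⊥
  _⊨_[_] (φ ∧ ψ) ρ = _⊨_[_] φ ρ × _⊨_[_] ψ ρ
  _⊨_[_] (φ ∨ ψ) ρ = _⊨_[_] φ ρ ⊎ _⊨_[_] ψ ρ
  _⊨_[_] (φ ⇒ ψ) ρ = _⊨_[_] φ ρ → _⊨_[_] ψ ρ
  _⊨_[_] (∀′ φ)  ρ = ∀ x → _⊨_[_] φ (x ∷ ρ)
  _⊨_[_] (∃′ φ)  ρ = ∃[ x ] _⊨_[_] φ (x ∷ ρ)

Theory : ∀ t → Set (lsuc t)
Theory t = Sentence → Set t

infix 3 _⊨_
_⊨_ : ∀ {ℓ t} → Structure ℓ → Theory t → Set _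
M ⊨ T = ∀ σ → T σ → M ⊨ σ [ [] ]

record DiscretelyOrderedRing (ℓ : Level) : Set (lsuc ℓ) where
  infix 4 _<_ _≤_
  field
    commutativeRing : CommutativeRing ℓ ℓ
  open CommutativeRing commutativeRing public
  field
    _<_                : Rel Carrier ℓ
    isStrictTotalOrder : IsStrictTotalOrder _≈_ _<_
    +-monoˡ-<          : ∀ z {x y} → x < y → x + z < y + z
    *-pos              : ∀ {x y} → 0# < x → 0# < y → 0# < x * y
    0<1                : 0# < 1#
    discrete           : ∀ {x} → 0# < x → ¬ (x < 1#)

  _≤_ : Rel Carrier ℓ
  x ≤ y = x < y ⊎ x ≈ y

  module Order = IsStrictTotalOrder isStrictTotalOrder
  open RingProperties ring public using (-‿distribˡ-*)

  <-cong : ∀ {x x′ y y′} → x ≈ x′ → y ≈ y′ → x < y → x′ < y′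
  <-cong p q x<y = Order.<-respˡ-≈ p (Order.<-respʳ-≈ q x<y)

  ≤-cong : ∀ {x x′ y y′} → x ≈ x′ → y ≈ y′ → x ≤ y → x′ ≤ y′
  ≤-cong p q (inj₁ x<y) = inj₁ (<-cong p q x<y)
  ≤-cong p q (inj₂ x≈y) = inj₂ (trans (sym p) (trans x≈y q))

  ≤-trans : ∀ {x y z} → x ≤ y → y ≤ z → x ≤ z
  ≤-trans (inj₁ p) (inj₁ q) = inj₁ (Order.trans p q)
  ≤-trans (inj₁ p) (inj₂ q) = inj₁ (Order.<-respʳ-≈ q p)
  ≤-trans (inj₂ p) q        = ≤-cong (sym p) refl q

  +-monoˡ-≤ : ∀ z {x y} → x ≤ y → x + z ≤ y + z
  +-monoˡ-≤ z (inj₁ p) = inj₁ (+-monoˡ-< z p)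
  +-monoˡ-≤ z (inj₂ p) = inj₂ (+-congʳ p)

  +-mono-≤ : ∀ {x x′ y y′} → x ≤ x′ → y ≤ y′ → x + y ≤ x′ + y′
  +-mono-≤ p q =
    ≤-trans (+-monoˡ-≤ _ p)
            (≤-cong (+-comm _ _) (+-comm _ _) (+-monoˡ-≤ _ q))

  +-nonneg : ∀ {x y} → 0# ≤ x → 0# ≤ y → 0# ≤ x + y
  +-nonneg p q = ≤-cong (+-identityˡ 0#) refl (+-mono-≤ p q)

  *-nonneg : ∀ {x y} → 0# ≤ x → 0# ≤ y → 0# ≤ x * y
  *-nonneg (inj₁ p) (inj₁ q) = inj₁ (*-pos p q)
  *-nonneg (inj₁ p) (inj₂ q) = inj₂ (trans (sym (zeroʳ _)) (*-congˡ q))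
  *-nonneg (inj₂ p) q        = inj₂ (trans (sym (zeroˡ _)) (*-congʳ p))

  *-monoˡ-≤ : ∀ {x y z} → 0# ≤ z → x ≤ y → x * z ≤ y * z
  *-monoˡ-≤ {x} {y} {z} 0≤z x≤y =
    ≤-cong (+-identityˡ _) cancel (+-monoˡ-≤ (x * z) (*-nonneg 0≤y-x 0≤z))
    where
    0≤y-x : 0# ≤ y + - x
    0≤y-x = ≤-cong (-‿inverseʳ x) refl (+-monoˡ-≤ (- x) x≤y)
    cancel : (y + - x) * z + x * z ≈ y * z
    cancel =
      trans (sym (distribʳ z (y + - x) x))
        (*-congʳ (trans (+-assoc y (- x) x)
          (trans (+-congˡ (-‿inverseˡ x)) (+-identityʳ y))))

  *-mono-≤ : ∀ {x x′ y y′} → 0# ≤ x′ → 0# ≤ y →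
             x ≤ x′ → y ≤ y′ → x * y ≤ x′ * y′
  *-mono-≤ 0≤x′ 0≤y p q =
    ≤-trans (*-monoˡ-≤ 0≤y p)
            (≤-cong (*-comm _ _) (*-comm _ _) (*-monoˡ-≤ 0≤x′ q))

nonNegativePart : ∀ {ℓ} → DiscretelyOrderedRing ℓ → Structure ℓ
nonNegativePart R = record
  { Carrier       = Σ[ x ∈ Carrier ] 0# ≤ x
  ; _≈_           = λ x y → proj₁ x ≈ proj₁ y
  ; isEquivalence = record { refl = refl ; sym = sym ; trans = trans }
  ; 0#            = 0# , inj₂ refl
  ; 1#            = 1# , inj₁ 0<1
  ; _+_           = λ (x , p) (y , q) → x + y , +-nonneg p q
  ; _*_           = λ (x , p) (y , q) → x * y , *-nonneg p q
  ; _<_           = λ x y → proj₁ x < proj₁ y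
  ; +-cong        = +-cong
  ; *-cong        = *-cong
  ; <-cong        = <-cong
  }
  where open DiscretelyOrderedRing R

PA⁻ : ∀ ℓ → Theory (lsuc ℓ)
PA⁻ ℓ σ = (R : DiscretelyOrderedRing ℓ) → nonNegativePart R ⊨ σ [ [] ]

-- φ is φ(y⃗ , x⃗ , z⃗) with |y⃗| = q, |x⃗| = p, |z⃗| = r. The outer context of the
-- matrix is u⃗ , z⃗; the renamings insert u⃗, respectively v⃗ and u⃗, between x⃗ and z⃗.

module _ {p q r : ℕ} (φ : Formula (q ℕ.+ (p ℕ.+ r))) where
  private
    u : Fin p → Fin (p ℕ.+ r)
    u i = i ↑ˡ r

    -- u⃗ in the context v⃗ , u⃗ , z⃗
    u′ : Fin p → Fin (q ℕ.+ (p ℕ.+ r))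
    u′ i = q ↑ʳ u i

    -- v⃗ in the context x⃗ , v⃗ , u⃗ , z⃗
    v : Fin q → Fin (p ℕ.+ (q ℕ.+ (p ℕ.+ r)))
    v j = p ↑ʳ (j ↑ˡ (p ℕ.+ r))

    φ-yxuz : Formula (q ℕ.+ (p ℕ.+ (p ℕ.+ r)))
    φ-yxuz = rename (lift q (lift p (λ i → p ↑ʳ i))) φ

    φ-yxvuz : Formula (q ℕ.+ (p ℕ.+ (q ℕ.+ (p ℕ.+ r))))
    φ-yxvuz = rename (lift q (lift p (λ i → q ↑ʳ (p ↑ʳ i)))) φ

  collection : Sentence
  collection =
    closure (∀<* u (∃* q φ-yxuz) ⇒ ∃* q (∀<* u′ (∃<* v φ-yxvuz)))

  strongCollection : Sentence
  strongCollection =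
    closure (∃* q (∀<* u′ (∃* q φ-yxvuz ⇒ ∃<* v φ-yxvuz)))

data Coll (Γ : FormulaClass) : Sentence → Set where
  coll : ∀ {p q r} {φ : Formula (q ℕ.+ (p ℕ.+ r))} →
         Γ φ → Coll Γ (collection {p} {q} {r} φ)

data Collₛ (Γ : FormulaClass) : Sentence → Set where
  collₛ : ∀ {p q r} {φ : Formula (q ℕ.+ (p ℕ.+ r))} →
          Γ φ → Collₛ Γ (strongCollection {p} {q} {r} φ)

-- M ⊆ N is an embedding: M is identified with its image in N.

infix 4 _⊆_
record _⊆_ {ℓ} (M N : Structure ℓ) : Set ℓ where
  private
    module M = Structure M
    module N = Structure N
  field
    ι         : M.Carrier → N.Carrier
    cong      : ∀ {x y} → x M.≈ y → ι x N.≈ ι y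
    injective : ∀ {x y} → ι x N.≈ ι y → x M.≈ y
    0#-homo   : ι M.0# N.≈ N.0#
    1#-homo   : ι M.1# N.≈ N.1#
    +-homo    : ∀ x y → ι (x M.+ y) N.≈ ι x N.+ ι y
    *-homo    : ∀ x y → ι (x M.* y) N.≈ ι x N.* ι y
    <-homo    : ∀ {x y} → x M.< y → ι x N.< ι y
    <-cancel  : ∀ {x y} → ι x N.< ι y → x M.< y

module _ {ℓ} {M N : Structure ℓ} where

  Elementary : FormulaClass → M ⊆ N → Set ℓ
  Elementary Γ f = ∀ {k} (φ : Formula k) → Γ φ → ∀ ρ →
    (M ⊨ φ [ ρ ]) ⇔ (N ⊨ φ [ map (_⊆_.ι f) ρ ])

-- sup_N(M) needs N ⊨ PA⁻ to be closed under + and ×.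

module _ {ℓ} {N : Structure ℓ} (N⊨PA⁻ : N ⊨ PA⁻ ℓ) where
  open Structure N

  private
    mono : (∀ {k} → Term k → Term k → Term k) → Sentence
    mono _∙_ = closure {4} (w ≼ x ⇒ y ≼ z ⇒ (w ∙ y) ≼ (x ∙ z))
      where
      w x y z : Term 4
      w = ` zero
      x = ` suc zero
      y = ` suc (suc zero)
      z = ` suc (suc (suc zero))

    +-mono : ∀ {w x y z} → w ≤ x → y ≤ z → w + y ≤ x + z
    +-mono {w} {x} {y} {z} = N⊨PA⁻ (mono _⊕_)
      (λ R _ _ _ _ → DiscretelyOrderedRing.+-mono-≤ R) z y x w

    *-mono : ∀ {w x y z} → w ≤ x → y ≤ z → w * y ≤ x * z
    *-mono {w} {x} {y} {z} = N⊨PA⁻ (mono _⊗_)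
      (λ R _ y x _ → DiscretelyOrderedRing.*-mono-≤ R (proj₂ x) (proj₂ y))
      z y x w

    ≤-respʳ : ∀ {x y z} → y ≈ z → x ≤ y → x ≤ z
    ≤-respʳ y≈z (inj₁ x<y) = inj₁ (<-cong refl y≈z x<y)
    ≤-respʳ y≈z (inj₂ x≈y) = inj₂ (trans x≈y y≈z)

  module _ {M : Structure ℓ} (f : M ⊆ N) where
    private
      module M = Structure M
    open _⊆_ f

    sup : Structure ℓ
    sup = record
      { Carrier       = Σ[ a ∈ Carrier ] Σ[ b ∈ M.Carrier ] a ≤ ι b
      ; _≈_           = λ x y → proj₁ x ≈ proj₁ y
      ; isEquivalence = record { refl = refl ; sym = sym ; trans = trans }
      ; 0#            = 0# , M.0# , inj₂ (sym 0#-homo)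
      ; 1#            = 1# , M.1# , inj₂ (sym 1#-homo)
      ; _+_           = λ (x , b , p) (y , c , q) →
          x + y , b M.+ c , ≤-respʳ (sym (+-homo b c)) (+-mono p q)
      ; _*_           = λ (x , b , p) (y , c , q) →
          x * y , b M.* c , ≤-respʳ (sym (*-homo b c)) (*-mono p q)
      ; _<_           = λ x y → proj₁ x < proj₁ y
      ; +-cong        = +-cong
      ; *-cong        = *-cong
      ; <-cong        = <-cong
      }

    sup⊆ : sup ⊆ N
    sup⊆ = record
      { ι         = proj₁
      ; cong      = λ p → p
      ; injective = λ p → p
      ; 0#-homo   = refl
      ; 1#-homo   = refl
      ; +-homo    = λ _ _ → refl
      ; *-homo    = λ _ _ → refl
      ; <-homo    = λ p → p
      ; <-cancel  = λ p → p
      }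

module _ {ℓ} (M : Structure ℓ) where

  ElementaryCondition : ℕ → Set (lsuc ℓ)
  ElementaryCondition n =
    ∀ (N : Structure ℓ) (N⊨PA⁻ : N ⊨ PA⁻ ℓ) (f : M ⊆ N) →
    Elementary AllFormulas f → Elementary (Σₙ (suc n)) (sup⊆ N⊨PA⁻ f)

  CollectionCondition : ℕ → Set (lsuc ℓ)
  CollectionCondition zero =
    ∀ (N : Structure ℓ) (N⊨PA⁻ : N ⊨ PA⁻ ℓ) (f : M ⊆ N) →
    Elementary (Σₙ 1) f → Elementary (Σₙ 1) (sup⊆ N⊨PA⁻ f)
  CollectionCondition n@(suc _) =
    (M ⊨ Coll (Σₙ n)) ×
    (∀ (N : Structure ℓ) (N⊨PA⁻ : N ⊨ PA⁻ ℓ) → N ⊨ Coll (Σₙ n) → (f : M ⊆ N) →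
     Elementary (Σₙ (suc n)) f → Elementary (Σₙ (suc n)) (sup⊆ N⊨PA⁻ f))

  Σₙ₊₂Condition : ℕ → Set (lsuc ℓ)
  Σₙ₊₂Condition n =
    ∀ (N : Structure ℓ) (N⊨PA⁻ : N ⊨ PA⁻ ℓ) (f : M ⊆ N) →
    Elementary (Σₙ (suc (suc n))) f → Elementary (Σₙ (suc n)) (sup⊆ N⊨PA⁻ f)

{-# OPTIONS --safe #-}
module Submission where

-- 1 ⇒ 2. If strong collection fails for φ, then no v⃗ ∈ M bounds the witnesses of
-- φ below some u⃗. In an ultrapower of M modulo an ultrafilter concentrating on
-- large v⃗, the class of the counterexamples x⃗(v⃗) lies below u⃗, so in sup(M), and
-- has a witness in the ultrapower but none in sup(M). Excluded middle for Σ-types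
-- acts as a choice operator, which gives both the ultrafilter and Łoś's theorem.
--
-- 2 ⇒ 3. Over models of collection for Πᵢ (i < n), bounded quantifiers are
-- absorbed by Πₙ, so the instance ∀ x⃗ < u⃗ (∃ y⃗ φ → ∃ y⃗ < v⃗ φ) of strong
-- collection with φ in Πₙ is a Πₙ₊₁ property of u⃗ and v⃗ and passes from M to N.
-- It confines witnesses with parameters in sup(M) to sup(M): Tarski–Vaught.
--
-- 3 ⇒ 4. By induction on i < n, collection for a Πᵢ formula is equivalent in
-- M and N to a Πᵢ₊₃ sentence, hence passes from M to N.

open import Defs
open import Axiom.ExcludedMiddle using (ExcludedMiddle)
open import Axiom.Extensionality.Propositional using (Extensionality; lower-extensionality)
open import Data.Bool.Base using (Bool; true; false; T)
open import Data.Empty using (⊥; ⊥-elim)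
open import Data.Fin.Base using (Fin; zero; suc; _↑ˡ_; _↑ʳ_; lift)
import Data.Fin.Base as Fin
open import Data.List.Base as List using (List; []; _∷_)
open import Data.List.Relation.Unary.All as All using (All; []; _∷_)
import Data.List.Relation.Unary.All.Properties as All
open import Data.Nat.Base using (ℕ; zero; suc; s≤s; _≤′_; ≤′-refl; ≤′-step)
import Data.Nat.Base as ℕ
open import Data.Nat.Properties
  using (+-assoc; ≤⇒≤′; m<n⇒m<1+n; n<1+n; m<1+n⇒m<n∨m≡n; <⇒≤; ≤-refl; m≤n⇒m≤1+n)
  renaming (<-trans to ℕ-<-trans)
open import Data.Product using (∃-syntax; Σ-syntax; _×_; _,_; proj₁; proj₂; uncurry)
open import Data.Product.Function.NonDependent.Propositional using (_×-⇔_)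
open import Data.Sum.Base using (_⊎_; inj₁; inj₂; [_,_]′)
open import Data.Sum.Function.Propositional using (_⊎-⇔_)
open import Data.Vec.Base
  using (Vec; []; _∷_; _++_; lookup; tabulate; map; replicate; splitAt)
open import Data.Vec.Properties
  using (lookup-++ˡ; lookup-++ʳ; lookup-cast₁; ++-assoc-eqFree; lookup∘tabulate;
         tabulate∘lookup; tabulate-∘; lookup-map; map-id; map-∘; map-++)
open import Function.Base using (id; _∘_; const; case_of_)
open import Function.Bundles using (_⇔_; mk⇔; Equivalence)
import Function.Construct.Composition as Composition
open import Function.Construct.Identity using (⇔-id)
open import Function.Construct.Symmetry using (⇔-sym)
open import Function.Related.TypeIsomorphisms using (→-cong-⇔)
open import Level using (Level; Lift; lower; 0ℓ) renaming (suc to lsuc; lift to lift↑)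
open import Relation.Binary.Core using (Rel)
open import Relation.Binary.Definitions using (Reflexive; Transitive; tri<; tri≈; tri>)
open import Relation.Binary.PropositionalEquality
  using (_≡_; _≗_; refl; sym; trans; cong; cong₂; subst; subst₂; module ≡-Reasoning)
open import Relation.Nullary using (¬_; Dec; yes; no)
open import Relation.Nullary.Decidable
  using (decidable-stable; isYes; toWitness; fromWitness)

open Equivalence using (to; from)

private variable
  ℓ a b c : Level
  A : Set a
  k l m n p q r : ℕ

-- Semantics of tuple quantifiers and collection

∀-cong-⇔ : {P : A → Set b} {Q : A → Set c} → (∀ x → P x ⇔ Q x) → (∀ x → P x) ⇔ (∀ x → Q x)
∀-cong-⇔ h = mk⇔ (λ f x → to (h x) (f x)) (λ f x → from (h x) (f x))

∃-cong-⇔ : {P : A → Set b} {Q : A → Set c} → (∀ x → P x ⇔ Q x) → (∃[ x ] P x) ⇔ (∃[ x ] Q x)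
∃-cong-⇔ h = mk⇔ (λ (x , p) → x , to (h x) p) (λ (x , p) → x , from (h x) p)

infixr 0 _⨾_
_⨾_ : {A : Set a} {B : Set b} {C : Set c} → A ⇔ B → B ⇔ C → A ⇔ C
f ⨾ g = g Composition.⇔-∘ f

subst-⇔ : (P : A → Set b) {x y : A} → x ≡ y → P x ⇔ P y
subst-⇔ P refl = ⇔-id _

-- A relation between environments, so that lifted, shifted and cast renamings compose without
-- function extensionality. The record wrapper lets unification recover `r`, `ρ` and `ρ′`.
record Reindexes {A : Set a} (r : Fin k → Fin l) (ρ : Vec A l) (ρ′ : Vec A k) : Set a where
  constructor reindexing
  field lookup-≡ : ∀ i → lookup ρ (r i) ≡ lookup ρ′ i
open Reindexes

reindexes-lift : ∀ {r : Fin k → Fin l} {ρ : Vec A l} {ρ′} (xs : Vec A m) →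
  Reindexes r ρ ρ′ → Reindexes (lift m r) (xs ++ ρ) (xs ++ ρ′)
reindexes-lift []       h = h
reindexes-lift (x ∷ xs) h = reindexing λ where
  zero    → refl
  (suc i) → lookup-≡ (reindexes-lift xs h) i

reindexes-assoc : ∀ (xs : Vec A m) (ys : Vec A q) (zs : Vec A k) →
  Reindexes (Fin.cast (sym (+-assoc m q k))) ((xs ++ ys) ++ zs) (xs ++ (ys ++ zs))
reindexes-assoc {m = m} {q} {k} xs ys zs = reindexing λ i →
  trans (sym (lookup-cast₁ (+-assoc m q k) ((xs ++ ys) ++ zs) i))
        (cong (λ ρ → lookup ρ i) (++-assoc-eqFree xs ys zs))

reindexes-++ˡ : (xs : Vec A m) (ρ : Vec A k) → Reindexes (_↑ˡ k) (xs ++ ρ) xs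
reindexes-++ˡ xs ρ = reindexing (lookup-++ˡ xs ρ)

reindexes-++ʳ : (xs : Vec A m) (ρ : Vec A k) → Reindexes (m ↑ʳ_) (xs ++ ρ) ρ
reindexes-++ʳ xs ρ = reindexing (lookup-++ʳ xs ρ)

reindexes-∘ : ∀ {r : Fin k → Fin l} {s : Fin l → Fin m} {ρ : Vec A m} {ρ′ ρ″} →
  Reindexes s ρ ρ′ → Reindexes r ρ′ ρ″ → Reindexes (s ∘ r) ρ ρ″
reindexes-∘ {r = r} h h′ = reindexing λ i → trans (lookup-≡ h (r i)) (lookup-≡ h′ i)

∀-split-⇔ : ∀ m {k} {P : Vec A (m ℕ.+ k) → Set b} →
  (∀ ρ → P ρ) ⇔ (∀ xs ys → P (xs ++ ys))
∀-split-⇔ m {P = P} = mk⇔ (λ f xs ys → f (xs ++ ys))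
  (λ f ρ → let xs , ys , ρ≡xs++ys = splitAt m ρ in subst P (sym ρ≡xs++ys) (f xs ys))

∃-split-⇔ : ∀ m {k} {P : Vec A (m ℕ.+ k) → Set b} →
  (∃[ ρ ] P ρ) ⇔ (∃[ xs ] ∃[ ys ] P (xs ++ ys))
∃-split-⇔ m {P = P} = mk⇔
  (λ (ρ , h) → let xs , ys , ρ≡xs++ys = splitAt m ρ in xs , ys , subst P ρ≡xs++ys h)
  (λ (xs , ys , h) → xs ++ ys , h)

-- The part of `strongCollection` under `∃* q`. It is isolated because this property of v⃗, u⃗, z⃗,
-- unlike the whole sentence, is simple enough to pass from `M` to `N`.
strongCollectionBody : Formula (q ℕ.+ (p ℕ.+ r)) → Formula (q ℕ.+ (p ℕ.+ r))
strongCollectionBody {q} {p} {r} φ =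
  ∀<* (λ i → q ↑ʳ (i ↑ˡ r)) (∃* q φ′ ⇒ ∃<* {q} (λ j → p ↑ʳ (j ↑ˡ (p ℕ.+ r))) φ′)
  where φ′ = rename (lift q (lift p (λ i → q ↑ʳ (p ↑ʳ i)))) φ

module Semantics (K : Structure ℓ) where
  open Structure K using (Carrier; _≈_; _<_; _+_; _*_)

  infix 4 _<*_
  _<*_ : Vec Carrier m → Vec Carrier m → Set _
  xs <* ys = ∀ i → lookup xs i < lookup ys i

  ⟦renameᵗ⟧ : ∀ (t : Term k) {r : Fin k → Fin l} {ρ ρ′} → Reindexes r ρ ρ′ →
    ⟦ K ⟧ (renameᵗ r t) ρ ≡ ⟦ K ⟧ t ρ′
  ⟦renameᵗ⟧ (` i)   h = lookup-≡ h i
  ⟦renameᵗ⟧ 𝟎       h = refl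
  ⟦renameᵗ⟧ 𝟏       h = refl
  ⟦renameᵗ⟧ (s ⊕ t) h = cong₂ _+_ (⟦renameᵗ⟧ s h) (⟦renameᵗ⟧ t h)
  ⟦renameᵗ⟧ (s ⊗ t) h = cong₂ _*_ (⟦renameᵗ⟧ s h) (⟦renameᵗ⟧ t h)

  rename-⊨ : ∀ (φ : Formula k) {r : Fin k → Fin l} {ρ ρ′} → Reindexes r ρ ρ′ →
    (K ⊨ rename r φ [ ρ ]) ⇔ (K ⊨ φ [ ρ′ ])
  rename-⊨ (s ≐ t) h = subst-⇔ id (cong₂ _≈_ (⟦renameᵗ⟧ s h) (⟦renameᵗ⟧ t h))
  rename-⊨ (s ≺ t) h = subst-⇔ id (cong₂ _<_ (⟦renameᵗ⟧ s h) (⟦renameᵗ⟧ t h))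
  rename-⊨ ⊥′      h = ⇔-id _
  rename-⊨ (φ ∧ ψ) h = rename-⊨ φ h ×-⇔ rename-⊨ ψ h
  rename-⊨ (φ ∨ ψ) h = rename-⊨ φ h ⊎-⇔ rename-⊨ ψ h
  rename-⊨ (φ ⇒ ψ) h = →-cong-⇔ (rename-⊨ φ h) (rename-⊨ ψ h)
  rename-⊨ (∀′ φ)  h = ∀-cong-⇔ λ x → rename-⊨ φ (reindexes-lift (x ∷ []) h)
  rename-⊨ (∃′ φ)  h = ∃-cong-⇔ λ x → rename-⊨ φ (reindexes-lift (x ∷ []) h)

  ∀*-⊨ : ∀ m {k} {φ : Formula (m ℕ.+ k)} {ρ} →
    (K ⊨ ∀* m φ [ ρ ]) ⇔ (∀ xs → K ⊨ φ [ xs ++ ρ ])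
  ∀*-⊨ zero    = mk⇔ (λ { h [] → h }) (λ h → h [])
  ∀*-⊨ (suc m) = ∀*-⊨ m ⨾ mk⇔ (λ { h (x ∷ xs) → h xs x }) (λ h xs x → h (x ∷ xs))

  ∃*-⊨ : ∀ m {k} {φ : Formula (m ℕ.+ k)} {ρ} →
    (K ⊨ ∃* m φ [ ρ ]) ⇔ (∃[ xs ] K ⊨ φ [ xs ++ ρ ])
  ∃*-⊨ zero    = mk⇔ (λ h → [] , h) (λ { ([] , h) → h })
  ∃*-⊨ (suc m) =
    ∃*-⊨ m ⨾ mk⇔ (λ (xs , x , h) → x ∷ xs , h) (λ { (x ∷ xs , h) → xs , x , h })

  closure-⊨ : ∀ {k} {φ : Formula k} → (K ⊨ closure φ [ [] ]) ⇔ (∀ ρ → K ⊨ φ [ ρ ])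
  closure-⊨ {zero}  = mk⇔ (λ { h [] → h }) (λ h → h [])
  closure-⊨ {suc k} = closure-⊨ {k} ⨾ mk⇔ (λ { h (x ∷ ρ) → h ρ x }) (λ h ρ x → h (x ∷ ρ))

  ⋀-⊨ : ∀ {m k} {φ : Fin m → Formula k} {ρ} → (K ⊨ ⋀ φ [ ρ ]) ⇔ (∀ i → K ⊨ φ i [ ρ ])
  ⋀-⊨ {zero}  = mk⇔ (λ _ ()) (λ _ → id)
  ⋀-⊨ {suc m} = mk⇔
    (λ { (h , _) zero → h ; (_ , hs) (suc i) → to ⋀-⊨ hs i })
    (λ h → h zero , from ⋀-⊨ (h ∘ suc))

  below-⊨ : ∀ {b : Fin m → Fin k} {ρ u} (xs : Vec Carrier m) → Reindexes b ρ u →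
    (K ⊨ below b [ xs ++ ρ ]) ⇔ (xs <* u)
  below-⊨ {m = m} {b = b} {ρ} xs h = ⋀-⊨ {m} ⨾ ∀-cong-⇔ λ i →
    subst-⇔ id (cong₂ _<_ (lookup-++ˡ xs ρ i) (trans (lookup-++ʳ xs ρ (b i)) (lookup-≡ h i)))

  ∀<*-⊨ : ∀ {b : Fin m → Fin k} {φ : Formula (m ℕ.+ k)} {ρ u} → Reindexes b ρ u →
    (K ⊨ ∀<* b φ [ ρ ]) ⇔ (∀ xs → xs <* u → K ⊨ φ [ xs ++ ρ ])
  ∀<*-⊨ {m = m} h = ∀*-⊨ m ⨾ ∀-cong-⇔ λ xs → →-cong-⇔ (below-⊨ xs h) (⇔-id _)

  ∃<*-⊨ : ∀ {b : Fin m → Fin k} {φ : Formula (m ℕ.+ k)} {ρ u} → Reindexes b ρ u →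
    (K ⊨ ∃<* b φ [ ρ ]) ⇔ (∃[ xs ] (xs <* u × K ⊨ φ [ xs ++ ρ ]))
  ∃<*-⊨ {m = m} h = ∃*-⊨ m ⨾ ∃-cong-⇔ λ xs → below-⊨ xs h ×-⇔ ⇔-id _

  module _ {p q r} (φ : Formula (q ℕ.+ (p ℕ.+ r))) where

    Collection StrongCollection : Set _
    Collection = ∀ (u : Vec Carrier p) (z : Vec Carrier r) →
      (∀ x → x <* u → Σ[ y ∈ Vec Carrier q ] K ⊨ φ [ y ++ (x ++ z) ]) →
      ∃[ v ] ∀ x → x <* u → Σ[ y ∈ Vec Carrier q ] (y <* v × K ⊨ φ [ y ++ (x ++ z) ])
    StrongCollection = ∀ (u : Vec Carrier p) (z : Vec Carrier r) → ∃[ v ] ∀ x → x <* u →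
      (Σ[ y ∈ Vec Carrier q ] K ⊨ φ [ y ++ (x ++ z) ]) →
      Σ[ y ∈ Vec Carrier q ] (y <* v × K ⊨ φ [ y ++ (x ++ z) ])

    private
      module _ (u : Vec Carrier p) (z : Vec Carrier r) where

        insert-u : ∀ (y : Vec Carrier q) (x : Vec Carrier p) →
          Reindexes (lift q (lift p (p ↑ʳ_))) (y ++ (x ++ (u ++ z))) (y ++ (x ++ z))
        insert-u y x = reindexes-lift y (reindexes-lift x (reindexes-++ʳ u z))

        insert-vu : ∀ (v : Vec Carrier q) (y : Vec Carrier q) (x : Vec Carrier p) →
          Reindexes (lift q (lift p (λ i → q ↑ʳ (p ↑ʳ i))))
            (y ++ (x ++ (v ++ (u ++ z)))) (y ++ (x ++ z))
        insert-vu v y x = reindexes-lift y (reindexes-lift x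
          (reindexes-∘ (reindexes-++ʳ v (u ++ z)) (reindexes-++ʳ u z)))

        u-bound : ∀ (v : Vec Carrier q) → Reindexes (λ i → q ↑ʳ (i ↑ˡ r)) (v ++ (u ++ z)) u
        u-bound v = reindexes-∘ (reindexes-++ʳ v (u ++ z)) (reindexes-++ˡ u z)

        v-bound : ∀ (v : Vec Carrier q) (x : Vec Carrier p) →
          Reindexes (λ j → p ↑ʳ (j ↑ˡ (p ℕ.+ r))) (x ++ (v ++ (u ++ z))) v
        v-bound v x = reindexes-∘ (reindexes-++ʳ x (v ++ (u ++ z))) (reindexes-++ˡ v (u ++ z))

    collection-⊨ : (K ⊨ collection {p} {q} {r} φ [ [] ]) ⇔ Collection
    collection-⊨ = closure-⊨ {p ℕ.+ r} ⨾ ∀-split-⇔ p ⨾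
      ∀-cong-⇔ λ u → ∀-cong-⇔ λ z → →-cong-⇔
        (∀<*-⊨ (reindexes-++ˡ u z) ⨾ ∀-cong-⇔ λ x → →-cong-⇔ (⇔-id _)
          (∃*-⊨ q ⨾ ∃-cong-⇔ λ y → rename-⊨ φ (insert-u u z y x)))
        (∃*-⊨ q ⨾ ∃-cong-⇔ λ v → ∀<*-⊨ (u-bound u z v) ⨾ ∀-cong-⇔ λ x → →-cong-⇔ (⇔-id _)
          (∃<*-⊨ (v-bound u z v x) ⨾ ∃-cong-⇔ λ y →
            ⇔-id _ ×-⇔ rename-⊨ φ (insert-vu u z v y x)))

    strongCollectionBody-⊨ : ∀ (v : Vec Carrier q) (u : Vec Carrier p) (z : Vec Carrier r) →
      (K ⊨ strongCollectionBody {q} {p} {r} φ [ v ++ (u ++ z) ]) ⇔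
      (∀ x → x <* u →
        (Σ[ y ∈ Vec Carrier q ] K ⊨ φ [ y ++ (x ++ z) ]) →
        Σ[ y ∈ Vec Carrier q ] (y <* v × K ⊨ φ [ y ++ (x ++ z) ]))
    strongCollectionBody-⊨ v u z =
      ∀<*-⊨ (u-bound u z v) ⨾ ∀-cong-⇔ λ x → →-cong-⇔ (⇔-id _) (→-cong-⇔
        (∃*-⊨ q ⨾ ∃-cong-⇔ λ y → rename-⊨ φ (insert-vu u z v y x))
        (∃<*-⊨ (v-bound u z v x) ⨾ ∃-cong-⇔ λ y →
          ⇔-id _ ×-⇔ rename-⊨ φ (insert-vu u z v y x)))

    strongCollection-⊨ : (K ⊨ strongCollection {p} {q} {r} φ [ [] ]) ⇔ StrongCollection
    strongCollection-⊨ = closure-⊨ {p ℕ.+ r} ⨾ ∀-split-⇔ p ⨾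
      ∀-cong-⇔ λ u → ∀-cong-⇔ λ z →
        ∃*-⊨ q ⨾ ∃-cong-⇔ λ v → strongCollectionBody-⊨ v u z

-- The arithmetical hierarchy over a family of structures

renameᵗ-cong : ∀ {r s : Fin k → Fin l} (t : Term k) → r ≗ s → renameᵗ r t ≡ renameᵗ s t
renameᵗ-cong (` i)   h = cong `_ (h i)
renameᵗ-cong 𝟎       h = refl
renameᵗ-cong 𝟏       h = refl
renameᵗ-cong (s ⊕ t) h = cong₂ _⊕_ (renameᵗ-cong s h) (renameᵗ-cong t h)
renameᵗ-cong (s ⊗ t) h = cong₂ _⊗_ (renameᵗ-cong s h) (renameᵗ-cong t h)

lift-cong : ∀ {r s : Fin k → Fin l} → r ≗ s → lift 1 r ≗ lift 1 s
lift-cong h zero    = refl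
lift-cong h (suc i) = cong suc (h i)

rename-cong : ∀ {r s : Fin k → Fin l} (φ : Formula k) → r ≗ s → rename r φ ≡ rename s φ
rename-cong (s ≐ t) h = cong₂ _≐_ (renameᵗ-cong s h) (renameᵗ-cong t h)
rename-cong (s ≺ t) h = cong₂ _≺_ (renameᵗ-cong s h) (renameᵗ-cong t h)
rename-cong ⊥′      h = refl
rename-cong (φ ∧ ψ) h = cong₂ _∧_ (rename-cong φ h) (rename-cong ψ h)
rename-cong (φ ∨ ψ) h = cong₂ _∨_ (rename-cong φ h) (rename-cong ψ h)
rename-cong (φ ⇒ ψ) h = cong₂ _⇒_ (rename-cong φ h) (rename-cong ψ h)
rename-cong (∀′ φ)  h = cong ∀′ (rename-cong φ (lift-cong h))
rename-cong (∃′ φ)  h = cong ∃′ (rename-cong φ (lift-cong h))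

-- The two sides agree only pointwise, which is why `rename-cong` is stated for pointwise equal
-- renamings.
lift-lift : ∀ m (r : Fin k → Fin l) → lift 1 (lift m r) ≗ lift (suc m) r
lift-lift m r zero    = refl
lift-lift m r (suc i) = refl

rename-∀* : ∀ m (φ : Formula (m ℕ.+ k)) (r : Fin k → Fin l) →
  rename r (∀* m φ) ≡ ∀* m (rename (lift m r) φ)
rename-∀* zero    φ r = refl
rename-∀* (suc m) φ r =
  trans (rename-∀* m (∀′ φ) r) (cong (∀* m ∘ ∀′) (rename-cong φ (lift-lift m r)))

rename-∃* : ∀ m (φ : Formula (m ℕ.+ k)) (r : Fin k → Fin l) →
  rename r (∃* m φ) ≡ ∃* m (rename (lift m r) φ)
rename-∃* zero    φ r = refl
rename-∃* (suc m) φ r =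
  trans (rename-∃* m (∃′ φ) r) (cong (∃* m ∘ ∃′) (rename-cong φ (lift-lift m r)))

-- Returns the bound of a renamed quantifier to the weakened form that `∀<` and `∃<` demand.
renameᵗ-weaken : ∀ (r : Fin k → Fin l) t →
  renameᵗ (lift 1 r) (renameᵗ suc t) ≡ renameᵗ suc (renameᵗ r t)
renameᵗ-weaken r (` i)   = refl
renameᵗ-weaken r 𝟎       = refl
renameᵗ-weaken r 𝟏       = refl
renameᵗ-weaken r (s ⊕ t) = cong₂ _⊕_ (renameᵗ-weaken r s) (renameᵗ-weaken r t)
renameᵗ-weaken r (s ⊗ t) = cong₂ _⊗_ (renameᵗ-weaken r s) (renameᵗ-weaken r t)

Δ₀-rename : ∀ {φ : Formula k} (r : Fin k → Fin l) → Δ₀ φ → Δ₀ (rename r φ)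
Δ₀-rename r (s ≐ t) = _ ≐ _
Δ₀-rename r (s ≺ t) = _ ≺ _
Δ₀-rename r ⊥′      = ⊥′
Δ₀-rename r (φ ∧ ψ) = Δ₀-rename r φ ∧ Δ₀-rename r ψ
Δ₀-rename r (φ ∨ ψ) = Δ₀-rename r φ ∨ Δ₀-rename r ψ
Δ₀-rename r (φ ⇒ ψ) = Δ₀-rename r φ ⇒ Δ₀-rename r ψ
Δ₀-rename r (∀< t φ) rewrite renameᵗ-weaken r t = ∀< (renameᵗ r t) (Δ₀-rename (lift 1 r) φ)
Δ₀-rename r (∃< t φ) rewrite renameᵗ-weaken r t = ∃< (renameᵗ r t) (Δ₀-rename (lift 1 r) φ)

mutual
  Σ-rename : ∀ n {φ : Formula k} (r : Fin k → Fin l) → Σₙ n φ → Σₙ n (rename r φ)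
  Σ-rename zero    r φ∈ = Δ₀-rename r φ∈
  Σ-rename (suc n) r (m , ψ , ψ∈ , refl) = m , _ , Π-rename n (lift m r) ψ∈ , rename-∃* m ψ r

  Π-rename : ∀ n {φ : Formula k} (r : Fin k → Fin l) → Πₙ n φ → Πₙ n (rename r φ)
  Π-rename zero    r φ∈ = Δ₀-rename r φ∈
  Π-rename (suc n) r (m , ψ , ψ∈ , refl) = m , _ , Σ-rename n (lift m r) ψ∈ , rename-∀* m ψ r

Σ⊆Π-suc : ∀ n {φ : Formula k} → Σₙ n φ → Πₙ (suc n) φ
Σ⊆Π-suc n φ∈ = 0 , _ , φ∈ , refl

Π⊆Σ-suc : ∀ n {φ : Formula k} → Πₙ n φ → Σₙ (suc n) φ
Π⊆Σ-suc n φ∈ = 0 , _ , φ∈ , refl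

mutual
  Σ⊆Σ-suc : ∀ n {φ : Formula k} → Σₙ n φ → Σₙ (suc n) φ
  Σ⊆Σ-suc zero    φ∈ = 0 , _ , φ∈ , refl
  Σ⊆Σ-suc (suc n) (m , ψ , ψ∈ , φ≡) = m , ψ , Π⊆Π-suc n ψ∈ , φ≡

  Π⊆Π-suc : ∀ n {φ : Formula k} → Πₙ n φ → Πₙ (suc n) φ
  Π⊆Π-suc zero    φ∈ = 0 , _ , φ∈ , refl
  Π⊆Π-suc (suc n) (m , ψ , ψ∈ , φ≡) = m , ψ , Σ⊆Σ-suc n ψ∈ , φ≡

Σ-mono : ∀ {n n′} {φ : Formula k} → n ≤′ n′ → Σₙ n φ → Σₙ n′ φ
Σ-mono ≤′-refl φ∈ = φ∈
Σ-mono (≤′-step n≤) φ∈ = Σ⊆Σ-suc _ (Σ-mono n≤ φ∈)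

Π-mono : ∀ {n n′} {φ : Formula k} → n ≤′ n′ → Πₙ n φ → Πₙ n′ φ
Π-mono ≤′-refl φ∈ = φ∈
Π-mono (≤′-step n≤) φ∈ = Π⊆Π-suc _ (Π-mono n≤ φ∈)

Δ₀⊆Σ : ∀ n {φ : Formula k} → Δ₀ φ → Σₙ n φ
Δ₀⊆Σ zero    φ∈ = φ∈
Δ₀⊆Σ (suc n) φ∈ = Σ⊆Σ-suc n (Δ₀⊆Σ n φ∈)

Δ₀⊆Π : ∀ n {φ : Formula k} → Δ₀ φ → Πₙ n φ
Δ₀⊆Π zero    φ∈ = φ∈
Δ₀⊆Π (suc n) φ∈ = Π⊆Π-suc n (Δ₀⊆Π n φ∈)

⋀-Δ₀ : ∀ {m k} {φ : Fin m → Formula k} → (∀ i → Δ₀ (φ i)) → Δ₀ (⋀ φ)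
⋀-Δ₀ {zero}  h = ⊥′ ⇒ ⊥′
⋀-Δ₀ {suc m} h = h zero ∧ ⋀-Δ₀ (h ∘ suc)

reindex : (Fin k → Fin l) → Vec A l → Vec A k
reindex r ρ = tabulate (lookup ρ ∘ r)

reindexes-reindex : ∀ (r : Fin k → Fin l) (ρ : Vec A l) → Reindexes r ρ (reindex r ρ)
reindexes-reindex r ρ = reindexing λ i → sym (lookup∘tabulate (lookup ρ ∘ r) i)

-- ∀<* b φ itself is not syntactically Δ₀ when φ is.
nested∀< : ∀ m {k} → (Fin m → Fin k) → Formula (m ℕ.+ k) → Formula k
nested∀< zero    b φ = φ
nested∀< (suc m) b φ =
  nested∀< m (b ∘ suc) (∀′ ((` zero) ≺ renameᵗ suc (` (m ↑ʳ b zero)) ⇒ φ))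

nested∀<-Δ₀ : ∀ m {k} {b : Fin m → Fin k} {φ} → Δ₀ φ → Δ₀ (nested∀< m b φ)
nested∀<-Δ₀ zero    φ∈ = φ∈
nested∀<-Δ₀ (suc m) φ∈ = nested∀<-Δ₀ m (∀< _ φ∈)

module _ (K : Structure ℓ) where
  open Structure K using (_<_)
  open Semantics K

  nested∀<-⊨ : ∀ m {k} {b : Fin m → Fin k} {φ ρ u} → Reindexes b ρ u →
    (K ⊨ nested∀< m b φ [ ρ ]) ⇔ (∀ xs → xs <* u → K ⊨ φ [ xs ++ ρ ])
  nested∀<-⊨ zero    h = mk⇔ (λ { φ⊨ [] _ → φ⊨ }) (λ φ⊨ → φ⊨ [] λ ())
  nested∀<-⊨ (suc m) {b = b} {ρ = ρ} {u₀ ∷ u} h =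
    nested∀<-⊨ m {u = u} (reindexing (lookup-≡ h ∘ suc)) ⨾ mk⇔
      (λ { φ⊨ (x ∷ xs) x<u → φ⊨ xs (x<u ∘ suc) x (subst (x <_) (sym (b₀≡u₀ xs)) (x<u zero)) })
      (λ φ⊨ xs xs<u x x<b₀ → φ⊨ (x ∷ xs) λ where
        zero    → subst (x <_) (b₀≡u₀ xs) x<b₀
        (suc i) → xs<u i)
    where
    b₀≡u₀ : ∀ xs → lookup (xs ++ ρ) (m ↑ʳ b zero) ≡ u₀
    b₀≡u₀ xs = trans (lookup-++ʳ xs ρ (b zero)) (lookup-≡ h zero)

-- Equivalence is taken over a whole family so that one and the same normal form serves every
-- member; with the family consisting of `M` and `N`, elementarity for that form then carries over
-- to the original formula.
module Definability (em : ExcludedMiddle ℓ) {J : Set} (𝕂 : J → Structure ℓ) where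
  open module 𝕊 j = Semantics (𝕂 j)

  infix 3 _≣_
  record _≣_ (φ ψ : Formula k) : Set ℓ where
    constructor pointwise
    field at : ∀ j ρ → (𝕂 j ⊨ φ [ ρ ]) ⇔ (𝕂 j ⊨ ψ [ ρ ])
  open _≣_

  ≣-trans : {φ ψ χ : Formula k} → φ ≣ ψ → ψ ≣ χ → φ ≣ χ
  ≣-trans e e′ = pointwise λ j ρ → at e j ρ ⨾ at e′ j ρ

  -- Membership up to equivalence: the classes `Σₙ` and `Πₙ` are syntactic, so implications and
  -- bounded quantifiers leave them and must be brought back to prenex form.
  record _∋_ (Γ : FormulaClass) (θ : Formula k) : Set ℓ where
    constructor equivalent
    field
      {formula} : Formula k
      formula∈  : Γ formula
      θ≣formula : θ ≣ formula

  ∋-resp : ∀ {Γ : FormulaClass} {θ θ′ : Formula k} → θ ≣ θ′ → Γ ∋ θ′ → Γ ∋ θ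
  ∋-resp e (equivalent φ∈ e′) = equivalent φ∈ (≣-trans e e′)

  ∋-mono : ∀ {Γ Γ′ : FormulaClass} {θ : Formula k} →
    (∀ {φ : Formula k} → Γ φ → Γ′ φ) → Γ ∋ θ → Γ′ ∋ θ
  ∋-mono Γ⊆Γ′ (equivalent φ∈ e) = equivalent (Γ⊆Γ′ φ∈) e

  ∋-refl : ∀ {Γ : FormulaClass} {θ : Formula k} → Γ θ → Γ ∋ θ
  ∋-refl θ∈ = equivalent θ∈ (pointwise λ _ _ → ⇔-id _)

  ∀*-resp : ∀ m {φ ψ : Formula (m ℕ.+ k)} → φ ≣ ψ → ∀* m φ ≣ ∀* m ψ
  ∀*-resp m e = pointwise λ j ρ →
    ∀*-⊨ j m ⨾ (∀-cong-⇔ λ xs → at e j (xs ++ ρ)) ⨾ ⇔-sym (∀*-⊨ j m)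

  ∃*-resp : ∀ m {φ ψ : Formula (m ℕ.+ k)} → φ ≣ ψ → ∃* m φ ≣ ∃* m ψ
  ∃*-resp m e = pointwise λ j ρ →
    ∃*-⊨ j m ⨾ (∃-cong-⇔ λ xs → at e j (xs ++ ρ)) ⨾ ⇔-sym (∃*-⊨ j m)

  ∀*-merge : ∀ m q (φ : Formula (q ℕ.+ (m ℕ.+ k))) →
    ∀* m (∀* q φ) ≣ ∀* (q ℕ.+ m) (rename (Fin.cast (sym (+-assoc q m k))) φ)
  ∀*-merge m q φ = pointwise λ j ρ →
    ∀*-⊨ j m ⨾ (∀-cong-⇔ λ xs → ∀*-⊨ j q)
    ⨾ mk⇔ (λ h ys xs → h xs ys) (λ h xs ys → h ys xs)
    ⨾ (∀-cong-⇔ λ ys → ∀-cong-⇔ λ xs → ⇔-sym (rename-⊨ j φ (reindexes-assoc ys xs ρ)))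
    ⨾ ⇔-sym (∀*-⊨ j (q ℕ.+ m) ⨾ ∀-split-⇔ q)

  ∃*-merge : ∀ m q (φ : Formula (q ℕ.+ (m ℕ.+ k))) →
    ∃* m (∃* q φ) ≣ ∃* (q ℕ.+ m) (rename (Fin.cast (sym (+-assoc q m k))) φ)
  ∃*-merge m q φ = pointwise λ j ρ →
    ∃*-⊨ j m ⨾ (∃-cong-⇔ λ xs → ∃*-⊨ j q)
    ⨾ mk⇔ (λ (xs , ys , h) → ys , xs , h) (λ (ys , xs , h) → xs , ys , h)
    ⨾ (∃-cong-⇔ λ ys → ∃-cong-⇔ λ xs → ⇔-sym (rename-⊨ j φ (reindexes-assoc ys xs ρ)))
    ⨾ ⇔-sym (∃*-⊨ j (q ℕ.+ m) ⨾ ∃-split-⇔ q)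

  ∃*-Π : ∀ n m {θ : Formula (m ℕ.+ k)} → Πₙ n ∋ θ → Σₙ (suc n) ∋ ∃* m θ
  ∃*-Π n m (equivalent φ∈ e) = equivalent (m , _ , φ∈ , refl) (∃*-resp m e)

  ∀*-Σ : ∀ n m {θ : Formula (m ℕ.+ k)} → Σₙ n ∋ θ → Πₙ (suc n) ∋ ∀* m θ
  ∀*-Σ n m (equivalent φ∈ e) = equivalent (m , _ , φ∈ , refl) (∀*-resp m e)

  ∃*-Σ : ∀ n m {θ : Formula (m ℕ.+ k)} → Σₙ (suc n) ∋ θ → Σₙ (suc n) ∋ ∃* m θ
  ∃*-Σ n m (equivalent (q , ψ , ψ∈ , refl) e) =
    ∋-resp (≣-trans (∃*-resp m e) (∃*-merge m q ψ))
      (∃*-Π n (q ℕ.+ m) (∋-refl (Π-rename n _ ψ∈)))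

  ∀*-Π : ∀ n m {θ : Formula (m ℕ.+ k)} → Πₙ (suc n) ∋ θ → Πₙ (suc n) ∋ ∀* m θ
  ∀*-Π n m (equivalent (q , ψ , ψ∈ , refl) e) =
    ∋-resp (≣-trans (∀*-resp m e) (∀*-merge m q ψ))
      (∀*-Σ n (q ℕ.+ m) (∋-refl (Σ-rename n _ ψ∈)))

  closure-Π : ∀ n {k} {θ : Formula k} → Πₙ (suc n) ∋ θ → Πₙ (suc n) ∋ closure θ
  closure-Π n {zero}  θ∈ = θ∈
  closure-Π n {suc k} θ∈ = closure-Π n (∀*-Π n 1 θ∈)

  private
    module _ {m p k} (φ : Formula (m ℕ.+ k)) (ψ : Formula (p ℕ.+ k)) where
      φ↑ ψ↑ : Formula (p ℕ.+ (m ℕ.+ k))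
      φ↑ = rename (p ↑ʳ_) φ
      ψ↑ = rename (lift p (m ↑ʳ_)) ψ

      φ↑⇒ψ↑ : ∀ j ys xs ρ → (𝕂 j ⊨ φ↑ ⇒ ψ↑ [ ys ++ (xs ++ ρ) ]) ⇔
        (𝕂 j ⊨ φ [ xs ++ ρ ] → 𝕂 j ⊨ ψ [ ys ++ ρ ])
      φ↑⇒ψ↑ j ys xs ρ = →-cong-⇔
        (rename-⊨ j φ (reindexes-++ʳ ys (xs ++ ρ)))
        (rename-⊨ j ψ (reindexes-lift ys (reindexes-++ʳ xs ρ)))

      prenex-Π : (∃* m φ ⇒ ∀* p ψ) ≣ ∀* m (∀* p (φ↑ ⇒ ψ↑))
      prenex-Π = pointwise λ j ρ → →-cong-⇔ (∃*-⊨ j m) (∀*-⊨ j p)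
        ⨾ mk⇔ (λ h xs ys φ⊨ → h (xs , φ⊨) ys) (λ h (xs , φ⊨) ys → h xs ys φ⊨)
        ⨾ (∀-cong-⇔ λ xs → (∀-cong-⇔ λ ys → ⇔-sym (φ↑⇒ψ↑ j ys xs ρ)) ⨾ ⇔-sym (∀*-⊨ j p))
        ⨾ ⇔-sym (∀*-⊨ j m)

      -- Classical: a counterexample to `φ`, if there is one, makes the implication hold with any
      -- ys; otherwise the premise is true and yields ys. The unconstrained tuple is filled with
      -- `0#`.
      prenex-Σ : (∀* m φ ⇒ ∃* p ψ) ≣ ∃* m (∃* p (φ↑ ⇒ ψ↑))
      prenex-Σ = pointwise λ j ρ → →-cong-⇔ (∀*-⊨ j m) (∃*-⊨ j p)
        ⨾ mk⇔ (witness j ρ) (λ (xs , ys , h) φ⊨ → ys , h (φ⊨ xs))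
        ⨾ (∃-cong-⇔ λ xs → (∃-cong-⇔ λ ys → ⇔-sym (φ↑⇒ψ↑ j ys xs ρ)) ⨾ ⇔-sym (∃*-⊨ j p))
        ⨾ ⇔-sym (∃*-⊨ j m)
        where
        module _ j (ρ : Vec (Structure.Carrier (𝕂 j)) k) where
          open Structure (𝕂 j) using (Carrier; 0#)
          witness : ((∀ xs → 𝕂 j ⊨ φ [ xs ++ ρ ]) → ∃[ ys ] 𝕂 j ⊨ ψ [ ys ++ ρ ]) →
            Σ[ xs ∈ Vec Carrier m ] Σ[ ys ∈ Vec Carrier p ]
              (𝕂 j ⊨ φ [ xs ++ ρ ] → 𝕂 j ⊨ ψ [ ys ++ ρ ])
          witness h with em {Σ[ xs ∈ Vec Carrier m ] ¬ (𝕂 j ⊨ φ [ xs ++ ρ ])}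
          ... | yes (xs , ¬φ) = xs , replicate p 0# , λ φ⊨ → ⊥-elim (¬φ φ⊨)
          ... | no  ¬∃¬φ =
            let ys , ψ⊨ = h λ xs → decidable-stable em λ ¬φ → ¬∃¬φ (xs , ¬φ)
            in replicate m 0# , ys , λ _ → ψ⊨

  ⇒-resp : ∀ {φ φ′ ψ ψ′ : Formula k} → φ ≣ φ′ → ψ ≣ ψ′ → (φ ⇒ ψ) ≣ (φ′ ⇒ ψ′)
  ⇒-resp e e′ = pointwise λ j ρ → →-cong-⇔ (at e j ρ) (at e′ j ρ)

  mutual
    -- After prenexing, premise and conclusion contribute quantifiers of the same kind, and the
    -- implication between the matrices is an instance of the dual lemma one level down.
    Σ⇒Π : ∀ n {φ ψ : Formula k} → Σₙ n ∋ φ → Πₙ n ∋ ψ → Πₙ n ∋ (φ ⇒ ψ)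
    Σ⇒Π zero    (equivalent φ∈ e) (equivalent ψ∈ e′) = equivalent (φ∈ ⇒ ψ∈) (⇒-resp e e′)
    Σ⇒Π (suc n) (equivalent (m , φ , φ∈ , refl) e) (equivalent (p , ψ , ψ∈ , refl) e′) =
      ∋-resp (≣-trans (⇒-resp e e′) (prenex-Π φ ψ))
        (∀*-Π n m (∀*-Σ n p
          (Π⇒Σ n (∋-refl (Π-rename n _ φ∈)) (∋-refl (Σ-rename n _ ψ∈)))))

    Π⇒Σ : ∀ n {φ ψ : Formula k} → Πₙ n ∋ φ → Σₙ n ∋ ψ → Σₙ n ∋ (φ ⇒ ψ)
    Π⇒Σ zero    (equivalent φ∈ e) (equivalent ψ∈ e′) = equivalent (φ∈ ⇒ ψ∈) (⇒-resp e e′)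
    Π⇒Σ (suc n) (equivalent (m , φ , φ∈ , refl) e) (equivalent (p , ψ , ψ∈ , refl) e′) =
      ∋-resp (≣-trans (⇒-resp e e′) (prenex-Σ φ ψ))
        (∃*-Σ n m (∃*-Π n p
          (Σ⇒Π n (∋-refl (Σ-rename n _ φ∈)) (∋-refl (Π-rename n _ ψ∈)))))

  Σ-¬ : ∀ n {φ : Formula k} → Πₙ n ∋ φ → Σₙ n ∋ (φ ⇒ ⊥′)
  Σ-¬ n φ∈ = Π⇒Σ n φ∈ (∋-refl (Δ₀⊆Σ n ⊥′))

  Π-¬ : ∀ n {φ : Formula k} → Σₙ n ∋ φ → Πₙ n ∋ (φ ⇒ ⊥′)
  Π-¬ n φ∈ = Σ⇒Π n φ∈ (∋-refl (Δ₀⊆Π n ⊥′))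

  Δ₀-∀<* : ∀ {b : Fin m → Fin k} {θ} → Δ₀ ∋ θ → Δ₀ ∋ ∀<* b θ
  Δ₀-∀<* {m} {b = b} (equivalent φ∈ e) = equivalent (nested∀<-Δ₀ m φ∈) (pointwise λ j ρ →
    ∀<*-⊨ j (reindexes-reindex b ρ)
    ⨾ (∀-cong-⇔ λ xs → →-cong-⇔ (⇔-id _) (at e j (xs ++ ρ)))
    ⨾ ⇔-sym (nested∀<-⊨ (𝕂 j) m (reindexes-reindex b ρ)))

  -- At successor levels the quantifier joins the leading universal block, with its guard as a Δ₀
  -- premise; at level 0 it is nested into single bounded quantifiers.
  Π-∀<* : ∀ n {b : Fin m → Fin k} {θ} → Πₙ n ∋ θ → Πₙ n ∋ ∀<* b θ
  Π-∀<* zero    θ∈ = Δ₀-∀<* θ∈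
  Π-∀<* {m} (suc n) θ∈ =
    ∀*-Π n m (Σ⇒Π (suc n) (∋-refl (Δ₀⊆Σ (suc n) (⋀-Δ₀ {m} λ i → _ ≺ _))) θ∈)

  CollectsBelow : ℕ → Set _
  CollectsBelow n = ∀ {i} → i ℕ.< n → ∀ j → 𝕂 j ⊨ Coll (Πₙ i)

  mutual
    -- Collection for the Πₙ matrix turns ∀ x⃗ < u⃗ ∃ y⃗ into ∃ v⃗ ∀ x⃗ < u⃗ ∃ y⃗ < v⃗, and
    -- conversely the bound is forgotten. Both bounded quantifiers are absorbed at level n, the
    -- inner one by recursion through `Π-∃<*`.
    Σ-∀<* : ∀ n → CollectsBelow n → ∀ {b : Fin m → Fin k} {θ} → Σₙ n ∋ θ → Σₙ n ∋ ∀<* b θ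
    Σ-∀<* zero _ θ∈ = Δ₀-∀<* θ∈
    Σ-∀<* {m} {k} (suc n) C {b} (equivalent (q , ψ , ψ∈ , refl) e) = ∋-resp e′
      (∃*-Π n q (Π-∀<* {m} n (Π-∃<* {q} n (C ∘ m<n⇒m<1+n) (∋-refl (Π-rename n _ ψ∈)))))
      where
      e′ : ∀<* b _ ≣
        ∃* q (∀<* (λ i → q ↑ʳ b i)
          (∃<* {q} (λ i → m ↑ʳ (i ↑ˡ k)) (rename (lift q (lift m (q ↑ʳ_))) ψ)))
      e′ = pointwise λ j ρ → let u = reindex b ρ ; ρ-u = reindexes-reindex b ρ in ∀<*-⊨ j ρ-u
        ⨾ (∀-cong-⇔ λ x → →-cong-⇔ (⇔-id _) (at e j (x ++ ρ) ⨾ ∃*-⊨ j q))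
        ⨾ mk⇔ (to (collection-⊨ j {m} {q} {k} ψ) (C (n<1+n n) j _ (coll {p = m} {q} {k} ψ∈)) u ρ)
              (λ (_ , h) x x<u → let y , _ , ψ⊨ = h x x<u in y , ψ⊨)
        ⨾ (∃-cong-⇔ λ v → ⇔-sym (
            ∀<*-⊨ j (reindexes-∘ (reindexes-++ʳ v ρ) ρ-u)
            ⨾ ∀-cong-⇔ λ x → →-cong-⇔ (⇔-id _)
              (∃<*-⊨ j (reindexes-∘ (reindexes-++ʳ x (v ++ ρ)) (reindexes-++ˡ v ρ))
              ⨾ ∃-cong-⇔ λ y → ⇔-id _ ×-⇔
                rename-⊨ j ψ (reindexes-lift y (reindexes-lift x (reindexes-++ʳ v ρ))))))
        ⨾ ⇔-sym (∃*-⊨ j q)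

    -- Dual to `Σ-∀<*`, through the classical reading of ∃ as ¬∀¬.
    Π-∃<* : ∀ n → CollectsBelow n → ∀ {b : Fin m → Fin k} {θ} → Πₙ n ∋ θ → Πₙ n ∋ ∃<* b θ
    Π-∃<* {m} n C {b} {θ} θ∈ = ∋-resp e (Π-¬ n (Σ-∀<* n C (Σ-¬ n θ∈)))
      where
      e : ∃<* b θ ≣ (∀<* b (θ ⇒ ⊥′) ⇒ ⊥′)
      e = pointwise λ j ρ → let ρ-u = reindexes-reindex b ρ in mk⇔
        (λ h ∀¬ → let x , x<u , θ⊨ = to (∃<*-⊨ j ρ-u) h in to (∀<*-⊨ j ρ-u) ∀¬ x x<u θ⊨)
        (λ ¬∀ → decidable-stable em λ ¬∃ → lower (¬∀ (from (∀<*-⊨ j ρ-u) λ x x<u θ⊨ →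
          lift↑ (¬∃ (from (∃<*-⊨ j ρ-u) (x , x<u , θ⊨))))))

-- Ultrafilters

-- Subsets are Bool-valued so that all subsets of X form a type in the same
-- universe as X and excluded middle applies to quantification over them.
module Subsets (em : ExcludedMiddle ℓ) (ext : Extensionality ℓ ℓ) where

  Subset : Set ℓ → Set ℓ
  Subset X = X → Bool

  infix 4 _∈_ _⊑_
  _∈_ : {X : Set ℓ} → X → Subset X → Set
  x ∈ F = T (F x)

  ⟨_⟩ : {X : Set ℓ} → (X → Set ℓ) → Subset X
  ⟨ P ⟩ x = isYes (em {P x})

  _⊑_ : {X : Set ℓ} → Subset X → Subset X → Set ℓ
  F ⊑ G = ∀ x → x ∈ F → x ∈ G

  ∈⟨⟩⁺ : {P : Set ℓ} → P → T (isYes (em {P}))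
  ∈⟨⟩⁺ = fromWitness

  ∈⟨⟩⁻ : {P : Set ℓ} → T (isYes (em {P})) → P
  ∈⟨⟩⁻ = toWitness

  ⊑-antisym : {X : Set ℓ} {F G : Subset X} → F ⊑ G → G ⊑ F → F ≡ G
  ⊑-antisym {F = F} {G} F⊑G G⊑F =
    lower-extensionality 0ℓ ℓ ext λ x → T-antisym (F x) (G x) (F⊑G x) (G⊑F x)
    where
    T-antisym : ∀ p q → (T p → T q) → (T q → T p) → p ≡ q
    T-antisym true  true  _ _ = refl
    T-antisym false false _ _ = refl
    T-antisym true  false h _ = ⊥-elim (h _)
    T-antisym false true  _ h = ⊥-elim (h _)

  ∀-or-∃¬ : {X : Set ℓ} (𝒮 : Subset (Subset X)) (P : Subset X → Set ℓ) →
    (∀ F → F ∈ 𝒮 → P F) ⊎ (∃[ F ] (F ∈ 𝒮 × ¬ P F))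
  ∀-or-∃¬ 𝒮 P with em {∃[ F ] (F ∈ 𝒮 × ¬ P F)}
  ... | yes h = inj₂ h
  ... | no ¬h = inj₁ λ F F∈𝒮 → decidable-stable em λ ¬P → ¬h (F , F∈𝒮 , ¬P)

  -- The Teichmüller–Tukey lemma for the property "C holds of every finite list
  -- of members": a maximal such set is the top of the tower generated from F₀ by
  -- unions and by adjoining one admissible element at a time, which is a chain
  -- by the Bourbaki–Witt argument.
  module Tukey {X : Set ℓ} (C : List X → Set ℓ) (F₀ : Subset X) where

    Consistent : Subset X → Set ℓ
    Consistent F = ∀ L → All (_∈ F) L → C L

    insert : X → Subset X → Subset X
    insert x F = ⟨ (λ y → Lift ℓ (y ∈ F) ⊎ y ≡ x) ⟩

    Extendable : Subset X → Set ℓ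
    Extendable F = Σ[ x ∈ X ] (¬ (x ∈ F) × Consistent (insert x F))

    -- The decision is an explicit argument so that abstracting over `em {Extendable F}` makes
    -- `next F` compute.
    next′ : (F : Subset X) → Dec (Extendable F) → Subset X
    next′ F (yes (x , _)) = insert x F
    next′ F (no  _)       = F

    next : Subset X → Subset X
    next F = next′ F em

    -- Including `F₀` makes it the empty union, so the tower starts at `F₀` without a further
    -- constructor.
    ⋃ : Subset (Subset X) → Subset X
    ⋃ 𝒮 = ⟨ (λ x → Lift ℓ (x ∈ F₀) ⊎ (∃[ F ] (F ∈ 𝒮 × x ∈ F))) ⟩

    data Tower : Subset X → Set ℓ where
      next-tower : ∀ {F} → Tower F → Tower (next F)
      ⋃-tower    : ∀ 𝒮 → (∀ F → F ∈ 𝒮 → Tower F) → Tower (⋃ 𝒮)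

    ⊑-next : ∀ F → F ⊑ next F
    ⊑-next F x x∈F with em {Extendable F}
    ... | yes _ = ∈⟨⟩⁺ (inj₁ (lift↑ x∈F))
    ... | no  _ = x∈F

    ∈-⊑-⋃ : ∀ {𝒮 F} → F ∈ 𝒮 → F ⊑ ⋃ 𝒮
    ∈-⊑-⋃ F∈𝒮 x x∈F = ∈⟨⟩⁺ (inj₂ (_ , F∈𝒮 , x∈F))

    ⋃-⊑ : ∀ {𝒮 G} → F₀ ⊑ G → (∀ F → F ∈ 𝒮 → F ⊑ G) → ⋃ 𝒮 ⊑ G
    ⋃-⊑ F₀⊑G 𝒮⊑G x x∈⋃ with ∈⟨⟩⁻ x∈⋃
    ... | inj₁ (lift↑ x∈F₀)     = F₀⊑G x x∈F₀
    ... | inj₂ (F , F∈𝒮 , x∈F) = 𝒮⊑G F F∈𝒮 x x∈F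

    F₀⊑tower : ∀ {F} → Tower F → F₀ ⊑ F
    F₀⊑tower (next-tower {F} t) x x∈F₀ = ⊑-next F x (F₀⊑tower t x x∈F₀)
    F₀⊑tower (⋃-tower 𝒮 t)      x x∈F₀ = ∈⟨⟩⁺ (inj₁ (lift↑ x∈F₀))

    -- Given `F ⊑ G`, the second alternative means that F and G coincide: `next` carries no stage
    -- strictly below `G` past it.
    Extreme : Subset X → Set ℓ
    Extreme G = ∀ {F} → Tower F → F ⊑ G → next F ⊑ G ⊎ G ⊑ F

    -- Induction on `F`. At a successor, extremality keeps `next F` below `G` unless F and G
    -- coincide. A union has all members below `G`, or one member already above `next G`.
    compare-extreme : ∀ {G} → Tower G → Extreme G → ∀ {F} → Tower F → F ⊑ G ⊎ next G ⊑ F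
    compare-extreme {G} tG extreme (next-tower {F} t) with compare-extreme tG extreme t
    ... | inj₂ nG⊑F = inj₂ λ x → ⊑-next F x ∘ nG⊑F x
    ... | inj₁ F⊑G with extreme t F⊑G
    ...   | inj₁ nF⊑G = inj₁ nF⊑G
    ...   | inj₂ G⊑F rewrite ⊑-antisym F⊑G G⊑F = inj₂ λ _ → id
    compare-extreme {G} tG extreme (⋃-tower 𝒮 t) with ∀-or-∃¬ 𝒮 (_⊑ G)
    ... | inj₁ 𝒮⊑G = inj₁ (⋃-⊑ (F₀⊑tower tG) 𝒮⊑G)
    ... | inj₂ (F , F∈𝒮 , F⋢G) with compare-extreme tG extreme (t F F∈𝒮)
    ...   | inj₁ F⊑G  = ⊥-elim (F⋢G F⊑G)
    ...   | inj₂ nG⊑F = inj₂ λ x → ∈-⊑-⋃ F∈𝒮 x ∘ nG⊑F x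

    -- Induction on `G`, locating `F` by `compare-extreme` at an earlier stage. For a union not
    -- below `F`, that stage is a member not below `F`.
    tower-extreme : ∀ {G} → Tower G → Extreme G
    tower-extreme (next-tower {G} t) tF F⊑nG with compare-extreme t (tower-extreme t) tF
    ... | inj₂ nG⊑F = inj₂ nG⊑F
    ... | inj₁ F⊑G with tower-extreme t tF F⊑G
    ...   | inj₁ nF⊑G = inj₁ λ x → ⊑-next G x ∘ nF⊑G x
    ...   | inj₂ G⊑F rewrite ⊑-antisym F⊑G G⊑F = inj₁ λ _ → id
    tower-extreme (⋃-tower 𝒮 t) {F} tF F⊑⋃ with ∀-or-∃¬ 𝒮 (_⊑ F)
    ... | inj₁ 𝒮⊑F = inj₂ (⋃-⊑ (F₀⊑tower tF) 𝒮⊑F)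
    ... | inj₂ (G , G∈𝒮 , G⋢F) with compare-extreme (t G G∈𝒮) (tower-extreme (t G G∈𝒮)) tF
    ...   | inj₂ nG⊑F = ⊥-elim (G⋢F λ x → nG⊑F x ∘ ⊑-next G x)
    ...   | inj₁ F⊑G with tower-extreme (t G G∈𝒮) tF F⊑G
    ...     | inj₁ nF⊑G = inj₁ λ x → ∈-⊑-⋃ G∈𝒮 x ∘ nF⊑G x
    ...     | inj₂ G⊑F  = ⊥-elim (G⋢F G⊑F)

    tower-chain : ∀ {F G} → Tower F → Tower G → F ⊑ G ⊎ G ⊑ F
    tower-chain {G = G} tF tG with compare-extreme tG (tower-extreme tG) tF
    ... | inj₁ F⊑G  = inj₁ F⊑G
    ... | inj₂ nG⊑F = inj₂ λ x → nG⊑F x ∘ ⊑-next G x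

    -- Finite character: since the tower is a chain, of the finitely many stages containing the
    -- entries one contains all. The first alternative covers lists drawn from `F₀` alone, for which
    -- 𝒮 may be empty.
    ⋃-finite : ∀ 𝒮 → (∀ F → F ∈ 𝒮 → Tower F) → ∀ L → All (_∈ ⋃ 𝒮) L →
      All (_∈ F₀) L ⊎ (∃[ F ] (F ∈ 𝒮 × All (_∈ F) L))
    ⋃-finite 𝒮 t []      []        = inj₁ []
    ⋃-finite 𝒮 t (x ∷ L) (x∈ ∷ L∈) with ∈⟨⟩⁻ x∈ | ⋃-finite 𝒮 t L L∈
    ... | inj₁ (lift↑ x∈F₀)    | inj₁ L∈F₀ = inj₁ (x∈F₀ ∷ L∈F₀)
    ... | inj₁ (lift↑ x∈F₀)    | inj₂ (F , F∈𝒮 , L∈F) =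
      inj₂ (F , F∈𝒮 , F₀⊑tower (t F F∈𝒮) x x∈F₀ ∷ L∈F)
    ... | inj₂ (F , F∈𝒮 , x∈F) | inj₁ L∈F₀ =
      inj₂ (F , F∈𝒮 , x∈F ∷ All.map (F₀⊑tower (t F F∈𝒮) _) L∈F₀)
    ... | inj₂ (F , F∈𝒮 , x∈F) | inj₂ (G , G∈𝒮 , L∈G) with tower-chain (t F F∈𝒮) (t G G∈𝒮)
    ...   | inj₁ F⊑G = inj₂ (G , G∈𝒮 , F⊑G x x∈F ∷ L∈G)
    ...   | inj₂ G⊑F = inj₂ (F , F∈𝒮 , x∈F ∷ All.map (G⊑F _) L∈G)

    module _ (F₀-consistent : Consistent F₀) where

      tower-consistent : ∀ {F} → Tower F → Consistent F
      tower-consistent (next-tower {F} t) with em {Extendable F}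
      ... | yes (_ , _ , consistent) = consistent
      ... | no  _                    = tower-consistent t
      tower-consistent (⋃-tower 𝒮 t) L L∈ with ⋃-finite 𝒮 t L L∈
      ... | inj₁ L∈F₀           = F₀-consistent L L∈F₀
      ... | inj₂ (F , F∈𝒮 , L∈F) = tower-consistent (t F F∈𝒮) L L∈F

      top : Subset X
      top = ⋃ ⟨ Tower ⟩

      top-tower : Tower top
      top-tower = ⋃-tower ⟨ Tower ⟩ λ _ → ∈⟨⟩⁻

      top-consistent : Consistent top
      top-consistent = tower-consistent top-tower

      F₀⊑top : F₀ ⊑ top
      F₀⊑top = F₀⊑tower top-tower

      -- `next top` is itself a stage, hence below `top`, whereas `next` adds a new element to an
      -- extendable set.
      top-not-extendable : ¬ Extendable top
      top-not-extendable e with em {Extendable top} | ∈-⊑-⋃ {⟨ Tower ⟩} (∈⟨⟩⁺ (next-tower top-tower))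
      ... | yes (x , x∉top , _) | next⊑top = x∉top (next⊑top x (∈⟨⟩⁺ (inj₂ refl)))
      ... | no ¬e               | _        = ¬e e

      top-maximal : ∀ x → Consistent (insert x top) → x ∈ top
      top-maximal x consistent = lower (decidable-stable (em {Lift ℓ (x ∈ top)}) λ x∉top →
        top-not-extendable (x , x∉top ∘ lift↑ , consistent))

record Ultrafilter (I : Set ℓ) : Set (lsuc ℓ) where
  field
    Large       : (I → Set ℓ) → Set ℓ
    large-mono  : ∀ {P Q : I → Set ℓ} → (∀ i → P i → Q i) → Large P → Large Q
    large-×     : ∀ {P Q : I → Set ℓ} → Large P → Large Q → Large (λ i → P i × Q i)
    large-∃     : ∀ {P : I → Set ℓ} → Large P → ∃[ i ] P i
    large-or-¬  : ∀ (P : I → Set ℓ) → Large P ⊎ Large (λ i → ¬ P i)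

module _ (em : ExcludedMiddle ℓ) (ext : Extensionality ℓ ℓ)
  {I : Set ℓ} (_≲_ : Rel I ℓ) (≲-refl : Reflexive _≲_) (≲-trans : Transitive _≲_)
  (directed : ∀ i j → ∃[ k ] (i ≲ k × j ≲ k)) (i₀ : I) where

  open Subsets em ext

  private
    -- With this condition, `Consistent` is the finite intersection property, whose maximal
    -- instances are the ultrafilters.
    Common : List (Subset I) → Set ℓ
    Common L = ∃[ i ] All (i ∈_) L

    tails : Subset (Subset I)
    tails = ⟨ (λ A → ∃[ i ] (∀ j → i ≲ j → j ∈ A)) ⟩

    -- Directedness gives a common later index. The induction carries a whole tail, not just a
    -- common point, so that the next tail can be met.
    tails-consistent : ∀ L → All (_∈ tails) L → ∃[ i ] (∀ j → i ≲ j → All (j ∈_) L)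
    tails-consistent []      []        = i₀ , λ _ _ → []
    tails-consistent (A ∷ L) (A∈ ∷ L∈) =
      let i , iA = ∈⟨⟩⁻ A∈ ; j , jL = tails-consistent L L∈ ; k , i≲k , j≲k = directed i j
      in k , λ l k≲l → iA l (≲-trans i≲k k≲l) ∷ jL l (≲-trans j≲k k≲l)

    open Tukey Common tails

    consistent : Consistent tails
    consistent L L∈ = let i , h = tails-consistent L L∈ in i , h i ≲-refl

    𝒰 : Subset (Subset I)
    𝒰 = top consistent

    Large : (I → Set ℓ) → Set ℓ
    Large P = Lift ℓ (⟨ P ⟩ ∈ 𝒰)

    -- By maximality, adjoining `A` breaks the finite intersection property. Deleting `A` from an
    -- offending list leaves members of `𝒰` whose intersection misses `A`.
    inconsistent : ∀ {A} → ¬ (A ∈ 𝒰) → ∃[ L ] (All (_∈ 𝒰) L × (∀ i → All (i ∈_) L → ¬ (i ∈ A)))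
    inconsistent {A} A∉𝒰 = decidable-stable em λ ¬∃ → A∉𝒰 (top-maximal consistent A λ L L∈ →
      let L′ , L′∈ , L′⇒L = strip L L∈ in
      decidable-stable em λ ¬common → ¬∃ (L′ , L′∈ , λ i i∈L′ i∈A → ¬common (i , L′⇒L i i∈A i∈L′)))
      where
      strip : ∀ L → All (_∈ insert A 𝒰) L →
        ∃[ L′ ] (All (_∈ 𝒰) L′ × (∀ i → i ∈ A → All (i ∈_) L′ → All (i ∈_) L))
      strip []      []        = [] , [] , λ _ _ _ → []
      strip (B ∷ L) (B∈ ∷ L∈) with ∈⟨⟩⁻ B∈ | strip L L∈
      ... | inj₁ (lift↑ B∈𝒰) | L′ , L′∈ , h =
        B ∷ L′ , B∈𝒰 ∷ L′∈ , λ { i i∈A (i∈B ∷ i∈L′) → i∈B ∷ h i i∈A i∈L′ }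
      ... | inj₂ refl        | L′ , L′∈ , h =
        L′ , L′∈ , λ i i∈A i∈L′ → i∈A ∷ h i i∈A i∈L′

    -- If neither P nor its complement is large, each comes with a finite subset
    -- of 𝒰 whose intersection misses it; their union is then inconsistent.
    large-or-¬ : ∀ P → Large P ⊎ Large (λ i → ¬ P i)
    large-or-¬ P with em {Large P} | em {Large (λ i → ¬ P i)}
    ... | yes h | _     = inj₁ h
    ... | no  _ | yes h = inj₂ h
    ... | no ¬h | no ¬h′ =
      let L  , L∈  , L⇒¬P  = inconsistent (¬h ∘ lift↑)
          L′ , L′∈ , L⇒¬¬P = inconsistent (¬h′ ∘ lift↑)
          i , i∈ = top-consistent consistent (L List.++ L′) (All.++⁺ L∈ L′∈)
      in ⊥-elim (L⇒¬¬P i (All.++⁻ʳ L i∈) (∈⟨⟩⁺ (L⇒¬P i (All.++⁻ˡ L i∈) ∘ ∈⟨⟩⁺)))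

    -- Otherwise the complement of `P` is large, and a point common to it and to `L` contradicts the
    -- entailment. Upward closure and closure under intersection are both instances.
    large-entails : ∀ L {P} → All (_∈ 𝒰) L → (∀ i → All (i ∈_) L → P i) → Large P
    large-entails L {P} L∈ L⇒P with large-or-¬ P
    ... | inj₁ h          = h
    ... | inj₂ (lift↑ h) with top-consistent consistent (⟨ (λ i → ¬ P i) ⟩ ∷ L) (h ∷ L∈)
    ...   | i , i∈¬P ∷ i∈L = ⊥-elim (∈⟨⟩⁻ i∈¬P (L⇒P i i∈L))

  tail-ultrafilter : Ultrafilter I
  tail-ultrafilter = record
    { Large      = Large
    ; large-mono = λ { P⇒Q (lift↑ h) → large-entails (_ ∷ []) (h ∷ [])
        λ { i (i∈P ∷ []) → P⇒Q i (∈⟨⟩⁻ i∈P) } }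
    ; large-×    = λ { (lift↑ h) (lift↑ h′) → large-entails (_ ∷ _ ∷ []) (h ∷ h′ ∷ [])
        λ { i (i∈P ∷ i∈Q ∷ []) → ∈⟨⟩⁻ i∈P , ∈⟨⟩⁻ i∈Q } }
    ; large-∃    = λ { (lift↑ h) → case top-consistent consistent (_ ∷ []) (h ∷ []) of
        λ { (i , i∈P ∷ []) → i , ∈⟨⟩⁻ i∈P } }
    ; large-or-¬ = large-or-¬
    }

  tails-large : ∀ i → Ultrafilter.Large tail-ultrafilter (i ≲_)
  tails-large i = lift↑ (F₀⊑top consistent _ (∈⟨⟩⁺ (i , λ _ → ∈⟨⟩⁺)))

-- Ultrapowers

module Ultrapower (em : ExcludedMiddle ℓ) (M : Structure ℓ) {I : Set ℓ} (𝒰 : Ultrafilter I) where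
  open Ultrafilter 𝒰
  private module M = Structure M

  large-all : {P : I → Set ℓ} → (∀ i → P i) → Large P
  large-all {P} h with large-or-¬ P
  ... | inj₁ large = large
  ... | inj₂ large = let i , ¬P = large-∃ large in ⊥-elim (¬P (h i))

  large-cong : {P Q : I → Set ℓ} → (∀ i → P i ⇔ Q i) → Large P ⇔ Large Q
  large-cong h = mk⇔ (large-mono (to ∘ h)) (large-mono (from ∘ h))

  large-const : {P : Set ℓ} → P ⇔ Large (λ _ → P)
  large-const = mk⇔ (large-all ∘ const) (proj₂ ∘ large-∃)

  large-×-⇔ : {P Q : I → Set ℓ} → (Large P × Large Q) ⇔ Large (λ i → P i × Q i)
  large-×-⇔ = mk⇔ (uncurry large-×) λ h → large-mono (λ _ → proj₁) h , large-mono (λ _ → proj₂) h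

  large-⊎-⇔ : {P Q : I → Set ℓ} → (Large P ⊎ Large Q) ⇔ Large (λ i → P i ⊎ Q i)
  large-⊎-⇔ {P} = mk⇔ [ large-mono (λ _ → inj₁) , large-mono (λ _ → inj₂) ]′ λ h →
    case large-or-¬ P of λ where
      (inj₁ large)  → inj₁ large
      (inj₂ large¬) → inj₂ (large-mono
        (λ { _ (inj₁ p , ¬p) → ⊥-elim (¬p p) ; _ (inj₂ q , _) → q }) (large-× h large¬))

  large-→-⇔ : {P Q : I → Set ℓ} → (Large P → Large Q) ⇔ Large (λ i → P i → Q i)
  large-→-⇔ {P} = mk⇔
    (λ h → case large-or-¬ P of λ where
      (inj₁ large)  → large-mono (λ _ → const) (h large)
      (inj₂ large¬) → large-mono (λ _ ¬p → ⊥-elim ∘ ¬p) large¬)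
    (λ h large → large-mono (λ _ (f , p) → f p) (large-× h large))

  large-∀-Fin : ∀ k {P : Fin k → I → Set ℓ} → (∀ j → Large (P j)) → Large (λ i → ∀ j → P j i)
  large-∀-Fin zero    h = large-all λ _ ()
  large-∀-Fin (suc k) h = large-mono
    (λ { _ (p , ps) zero → p ; _ (p , ps) (suc j) → ps j })
    (large-× (h zero) (large-∀-Fin k (h ∘ suc)))

  choose : (P : I → M.Carrier → Set ℓ) → I → M.Carrier
  choose P i with em {∃[ x ] P i x}
  ... | yes (x , _) = x
  -- An arbitrary value: the specification speaks only of indices that have a witness.
  ... | no  _       = M.0#

  choose-spec : (P : I → M.Carrier → Set ℓ) → ∀ i → ∃[ x ] P i x → P i (choose P i)
  choose-spec P i ∃x with em {∃[ x ] P i x}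
  ... | yes (_ , p) = p
  ... | no ¬∃x      = ⊥-elim (¬∃x ∃x)

  large-∃-⇔ : {P : I → M.Carrier → Set ℓ} →
    (∃[ f ] Large (λ i → P i (f i))) ⇔ Large (λ i → ∃[ x ] P i x)
  large-∃-⇔ {P} = mk⇔ (λ (f , h) → large-mono (λ i p → f i , p) h)
    (λ h → choose P , large-mono (choose-spec P) h)

  -- The function tested is one that picks a counterexample wherever one exists; if `P` holds even
  -- there, no counterexample exists at that index.
  large-∀-⇔ : {P : I → M.Carrier → Set ℓ} →
    (∀ f → Large (λ i → P i (f i))) ⇔ Large (λ i → ∀ x → P i x)
  large-∀-⇔ {P} = mk⇔
    (λ h → large-mono (λ i p x → decidable-stable em λ ¬p → choose-spec (λ i x → ¬ P i x) i (x , ¬p) p)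
                      (h (choose λ i x → ¬ P i x)))
    (λ h f → large-mono (λ i p → p (f i)) h)

  ultrapower : Structure ℓ
  ultrapower = record
    { Carrier       = I → M.Carrier
    ; _≈_           = λ f g → Large (λ i → f i M.≈ g i)
    ; isEquivalence = record
      { refl  = large-all λ _ → M.refl
      ; sym   = large-mono λ _ → M.sym
      ; trans = λ p q → large-mono (λ _ → uncurry M.trans) (large-× p q)
      }
    ; 0#            = λ _ → M.0#
    ; 1#            = λ _ → M.1#
    ; _+_           = λ f g i → f i M.+ g i
    ; _*_           = λ f g i → f i M.* g i
    ; _<_           = λ f g → Large (λ i → f i M.< g i)
    ; +-cong        = λ p q → large-mono (λ _ → uncurry M.+-cong) (large-× p q)
    ; *-cong        = λ p q → large-mono (λ _ → uncurry M.*-cong) (large-× p q)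
    ; <-cong        = λ p q r → large-mono (λ _ ((p , q) , r) → M.<-cong p q r) (large-× (large-× p q) r)
    }

  eval : I → Vec (I → M.Carrier) k → Vec M.Carrier k
  eval i = map λ f → f i

  ⟦⟧-eval : ∀ (t : Term k) ρ i → ⟦ ultrapower ⟧ t ρ i ≡ ⟦ M ⟧ t (eval i ρ)
  ⟦⟧-eval (` j)   ρ i = sym (lookup-map j (λ f → f i) ρ)
  ⟦⟧-eval 𝟎       ρ i = refl
  ⟦⟧-eval 𝟏       ρ i = refl
  ⟦⟧-eval (s ⊕ t) ρ i = cong₂ M._+_ (⟦⟧-eval s ρ i) (⟦⟧-eval t ρ i)
  ⟦⟧-eval (s ⊗ t) ρ i = cong₂ M._*_ (⟦⟧-eval s ρ i) (⟦⟧-eval t ρ i)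

  łoś : ∀ (φ : Formula k) ρ → (ultrapower ⊨ φ [ ρ ]) ⇔ Large (λ i → M ⊨ φ [ eval i ρ ])
  łoś (s ≐ t) ρ = large-cong λ i → subst-⇔ id (cong₂ M._≈_ (⟦⟧-eval s ρ i) (⟦⟧-eval t ρ i))
  łoś (s ≺ t) ρ = large-cong λ i → subst-⇔ id (cong₂ M._<_ (⟦⟧-eval s ρ i) (⟦⟧-eval t ρ i))
  łoś ⊥′      ρ = large-const
  łoś (φ ∧ ψ) ρ = łoś φ ρ ×-⇔ łoś ψ ρ ⨾ large-×-⇔
  łoś (φ ∨ ψ) ρ = łoś φ ρ ⊎-⇔ łoś ψ ρ ⨾ large-⊎-⇔
  łoś (φ ⇒ ψ) ρ = →-cong-⇔ (łoś φ ρ) (łoś ψ ρ) ⨾ large-→-⇔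
  łoś (∀′ φ)  ρ = (∀-cong-⇔ λ f → łoś φ (f ∷ ρ)) ⨾ large-∀-⇔
  łoś (∃′ φ)  ρ = (∃-cong-⇔ λ f → łoś φ (f ∷ ρ)) ⨾ large-∃-⇔

  diagonal : M ⊆ ultrapower
  diagonal = record
    { ι         = const
    ; cong      = to large-const
    ; injective = from large-const
    ; 0#-homo   = large-all λ _ → M.refl
    ; 1#-homo   = large-all λ _ → M.refl
    ; +-homo    = λ _ _ → large-all λ _ → M.refl
    ; *-homo    = λ _ _ → large-all λ _ → M.refl
    ; <-homo    = to large-const
    ; <-cancel  = from large-const
    }

  eval-const : ∀ i (ρ : Vec M.Carrier k) → eval i (map const ρ) ≡ ρ
  eval-const i ρ = trans (sym (map-∘ (λ f → f i) const ρ)) (map-id ρ)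

  diagonal-elementary : Elementary AllFormulas diagonal
  diagonal-elementary φ _ ρ = large-const
    ⨾ (large-cong λ i → subst-⇔ (M ⊨ φ [_]) (sym (eval-const i ρ)))
    ⨾ ⇔-sym (łoś φ (map const ρ))

-- Transfer along embeddings and the supremum of a submodel

-- `PA⁻` consists of the sentences true in all non-negative parts, so an order fact about `K` is
-- obtained by coding it as a sentence and checking that in every ring.
module PA⁻-Properties {K : Structure ℓ} (K⊨PA⁻ : K ⊨ PA⁻ ℓ) where
  open Structure K

  <-trans : ∀ {x y z} → x < y → y < z → x < z
  <-trans {x} {y} {z} = K⊨PA⁻
    (closure {3} ((` zero) ≺ (` suc zero) ⇒ (` suc zero) ≺ (` suc (suc zero)) ⇒
                  (` zero) ≺ (` suc (suc zero))))
    (λ R _ _ _ → DiscretelyOrderedRing.Order.trans R) z y x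

  <-total : ∀ x y → x ≤ y ⊎ y < x
  <-total x y = K⊨PA⁻
    (closure {2} ((` zero) ≼ (` suc zero) ∨ (` suc zero) ≺ (` zero)))
    (λ R (y , _) (x , _) → case DiscretelyOrderedRing.Order.compare R x y of λ where
      (tri< x<y _ _) → inj₁ (inj₁ x<y)
      (tri≈ _ x≈y _) → inj₁ (inj₂ x≈y)
      (tri> _ _ y<x) → inj₂ y<x) y x

  x<x+1 : ∀ x → x < x + 1#
  x<x+1 = K⊨PA⁻ (closure {1} ((` zero) ≺ (` zero) ⊕ 𝟏)) λ R (x , _) →
    let open DiscretelyOrderedRing R in
    DiscretelyOrderedRing.<-cong R (+-identityˡ x) (+-comm _ x) (+-monoˡ-< x 0<1)

  <-≤-trans : ∀ {x y z} → x < y → y ≤ z → x < z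
  <-≤-trans x<y (inj₁ y<z) = <-trans x<y y<z
  <-≤-trans x<y (inj₂ y≈z) = <-cong (Structure.refl K) y≈z x<y

  ≤-<-trans : ∀ {x y z} → x ≤ y → y < z → x < z
  ≤-<-trans (inj₁ x<y) y<z = <-trans x<y y<z
  ≤-<-trans (inj₂ x≈y) y<z = <-cong (Structure.sym K x≈y) (Structure.refl K) y<z

module Transfer (em : ExcludedMiddle ℓ) {M N : Structure ℓ} (f : M ⊆ N) where
  open _⊆_ f using (ι)

  pair : Bool → Structure ℓ
  pair true  = M
  pair false = N

  open Definability em pair public

  transfer : {Γ : FormulaClass} {θ : Formula k} → Elementary Γ f → Γ ∋ θ → ∀ ρ →
    (M ⊨ θ [ ρ ]) ⇔ (N ⊨ θ [ map ι ρ ])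
  transfer Γ-elem (equivalent {φ} φ∈ (pointwise e)) ρ =
    e true ρ ⨾ Γ-elem φ φ∈ ρ ⨾ ⇔-sym (e false (map ι ρ))

  Π-elementary : ∀ n → Elementary (Σₙ n) f → Elementary (Πₙ n) f
  Π-elementary n Σ-elem φ φ∈ ρ =
    ¬¬-⇔ ⨾ →-cong-⇔ (transfer Σ-elem (Σ-¬ n (∋-refl φ∈)) ρ) (⇔-id _) ⨾ ⇔-sym ¬¬-⇔
    where
    ¬¬-⇔ : {P : Set ℓ} → P ⇔ ((P → Lift ℓ ⊥) → Lift ℓ ⊥)
    ¬¬-⇔ = mk⇔ (λ x ¬x → ¬x x) (λ ¬¬x → decidable-stable em λ ¬x → lower (¬¬x (lift↑ ∘ ¬x)))

  -- The premise is Πₙ₊₂ and the conclusion Σₙ₊₁, by absorption of its bounded quantifiers. The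
  -- implication is then Σₙ₊₂, and the universal closure adds one level.
  Π∋collection : ∀ n → CollectsBelow n → ∀ {p q r} {φ : Formula (q ℕ.+ (p ℕ.+ r))} →
    Πₙ n φ → Πₙ (suc (suc (suc n))) ∋ collection {p} {q} {r} φ
  Π∋collection n C {p} {q} {r} φ∈ =
    closure-Π (suc (suc n)) {p ℕ.+ r} (∋-mono (Σ⊆Π-suc (suc (suc n))) (Π⇒Σ (suc (suc n))
      (Π-∀<* {p} (suc (suc n)) (∋-mono (Σ⊆Π-suc (suc n)) (∃*-Π n q (∋-refl (Π-rename n _ φ∈)))))
      (∋-mono (Σ⊆Σ-suc (suc n)) (∃*-Π n q
        (Π-∀<* {p} n (Π-∃<* {q} n C (∋-refl (Π-rename n _ φ∈))))))))

  -- The premise ∃ y⃗ φ is Σₙ₊₁, and absorption keeps the conclusion ∃ y⃗ < v⃗ φ in Πₙ.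
  Π∋strongCollectionBody : ∀ n → CollectsBelow n → ∀ {p q r} {φ : Formula (q ℕ.+ (p ℕ.+ r))} →
    Πₙ n φ → Πₙ (suc n) ∋ strongCollectionBody {q} {p} {r} φ
  Π∋strongCollectionBody n C {p} {q} φ∈ = Π-∀<* {p} (suc n) (Σ⇒Π (suc n)
    (∃*-Π n q (∋-refl (Π-rename n _ φ∈)))
    (∋-mono (Π⊆Π-suc n) (Π-∃<* {q} n C (∋-refl (Π-rename n _ φ∈)))))

  collectsBelow : ∀ n →
    (∀ {i} → i ℕ.< n → M ⊨ Coll (Πₙ i)) → (∀ {i} → i ℕ.< n → N ⊨ Coll (Πₙ i)) →
    CollectsBelow n
  collectsBelow n CM CN i<n true  = CM i<n
  collectsBelow n CM CN i<n false = CN i<n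

  -- One level at a time: reducing collection for Πₖ to a Πₖ₊₃ sentence over both structures uses
  -- collection below k in `N`, already transferred. As k < n, that sentence is within Πₙ₊₂.
  collection-transfer : ∀ n → Elementary (Σₙ (suc (suc n))) f →
    (∀ {i} → i ℕ.< n → M ⊨ Coll (Πₙ i)) → ∀ {i} → i ℕ.< n → N ⊨ Coll (Πₙ i)
  collection-transfer n Σ-elem CM = go n ≤-refl
    where
    go : ∀ k → k ℕ.≤ n → ∀ {i} → i ℕ.< k → N ⊨ Coll (Πₙ i)
    go (suc k) k<n i<1+k with m<1+n⇒m<n∨m≡n i<1+k
    ... | inj₁ i<k = go k (<⇒≤ k<n) i<k
    ... | inj₂ refl = λ { σ (coll {p} {q} {r} φ∈) →
      to (transfer (Π-elementary (suc (suc n)) Σ-elem)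
            (∋-mono (Π-mono (≤⇒≤′ (s≤s (s≤s k<n))))
              (Π∋collection k
                (collectsBelow k (λ i<k → CM (ℕ-<-trans i<k k<n)) (go k (<⇒≤ k<n)))
                {p} {q} {r} φ∈)) [])
         (CM k<n σ (coll {p = p} {q} {r} φ∈)) }

Coll-mono : {Γ Γ′ : FormulaClass} {K : Structure ℓ} → (∀ {k} {φ : Formula k} → Γ φ → Γ′ φ) →
  K ⊨ Coll Γ′ → K ⊨ Coll Γ
Coll-mono Γ⊆Γ′ C σ (coll {p} {q} {r} φ∈) = C σ (coll {p = p} {q} {r} (Γ⊆Γ′ φ∈))

module _ {K : Structure ℓ} where
  open Semantics K

  Collₛ⇒Coll : {Γ : FormulaClass} → K ⊨ Collₛ Γ → K ⊨ Coll Γ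
  Collₛ⇒Coll C σ (coll {p} {q} {r} {φ} φ∈) = from (collection-⊨ {p} {q} {r} φ) λ u z h →
    let v , bounded = to (strongCollection-⊨ {p} {q} {r} φ) (C _ (collₛ {p = p} {q} {r} φ∈)) u z
    in v , λ x x<u → bounded x x<u (h x x<u)

  -- The witnesses w of the inner existential block are collected jointly with y; afterwards the
  -- bound on w is dropped.
  CollΠ⇒CollΣ-suc : ∀ n → K ⊨ Coll (Πₙ n) → K ⊨ Coll (Σₙ (suc n))
  CollΠ⇒CollΣ-suc n C σ (coll {p} {q} {r} (m , ψ , ψ∈ , refl)) =
    from (collection-⊨ {p} {q} {r} (∃* m ψ)) λ u z h →
    let φ = rename (Fin.cast (sym (+-assoc m q (p ℕ.+ r)))) ψ
        merge : ∀ w y ρ → (K ⊨ φ [ (w ++ y) ++ ρ ]) ⇔ (K ⊨ ψ [ w ++ (y ++ ρ) ])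
        merge = λ w y ρ → rename-⊨ ψ (reindexes-assoc w y ρ)
        wv , bounded = to (collection-⊨ {p} {m ℕ.+ q} {r} φ)
          (C _ (coll {p = p} {m ℕ.+ q} {r} (Π-rename n _ ψ∈))) u z λ x x<u →
            let y , ∃w = h x x<u ; w , ψ⊨ = to (∃*-⊨ m) ∃w in w ++ y , from (merge w y _) ψ⊨
        w₀ , v , wv≡ = splitAt m wv
    in v , λ x x<u → let wy , wy<wv , φ⊨ = bounded x x<u ; w , y , wy≡ = splitAt m wy in
      y , (λ j → subst₂ _<_
             (trans (cong (λ ρ → lookup ρ (m ↑ʳ j)) wy≡) (lookup-++ʳ w y j))
             (trans (cong (λ ρ → lookup ρ (m ↑ʳ j)) wv≡) (lookup-++ʳ w₀ v j)) (wy<wv (m ↑ʳ j)))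
        , from (∃*-⊨ m) (w , to (merge w y _) (subst (λ ρ → K ⊨ φ [ ρ ++ (x ++ z) ]) wy≡ φ⊨))
    where open Structure K using (_<_)

module Sup {M N : Structure ℓ} (M⊨PA⁻ : M ⊨ PA⁻ ℓ) (N⊨PA⁻ : N ⊨ PA⁻ ℓ) (f : M ⊆ N) where
  private
    module M = Structure M
    module N = Structure N
  open _⊆_ f using (ι; <-homo)
  open PA⁻-Properties N⊨PA⁻

  S : Structure ℓ
  S = sup N⊨PA⁻ f
  private module S = Structure S

  -- Elements of the supremum are weakly below `M`, while the tuple bounds of collection are strict;
  -- hence the added 1.
  strictBound : S.Carrier → M.Carrier
  strictBound (_ , b , _) = b M.+ M.1#

  <strictBound : ∀ s → proj₁ s N.< ι (strictBound s)
  <strictBound (_ , b , a≤b) = ≤-<-trans a≤b (<-homo (PA⁻-Properties.x<x+1 M⊨PA⁻ b))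

  ⟦⟧-sup : ∀ (t : Term k) ρ → proj₁ (⟦ S ⟧ t ρ) ≡ ⟦ N ⟧ t (map proj₁ ρ)
  ⟦⟧-sup (` i)   ρ = sym (lookup-map i proj₁ ρ)
  ⟦⟧-sup 𝟎       ρ = refl
  ⟦⟧-sup 𝟏       ρ = refl
  ⟦⟧-sup (s ⊕ t) ρ = cong₂ N._+_ (⟦⟧-sup s ρ) (⟦⟧-sup t ρ)
  ⟦⟧-sup (s ⊗ t) ρ = cong₂ N._*_ (⟦⟧-sup s ρ) (⟦⟧-sup t ρ)

  below-element : ∀ {x} (s : S.Carrier) → x N.< proj₁ s → ∃[ b ] x N.≤ ι b
  below-element (_ , b , a≤b) x<a = b , inj₁ (<-≤-trans x<a a≤b)

  below-term : ∀ (t : Term k) ρ {x} → x N.< ⟦ N ⟧ (renameᵗ suc t) (x ∷ map proj₁ ρ) →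
    ∃[ b ] x N.≤ ι b
  below-term t ρ {x} x<t = below-element (⟦ S ⟧ t ρ) (subst (x N.<_)
    (trans (Semantics.⟦renameᵗ⟧ N t (reindexing λ _ → refl)) (sym (⟦⟧-sup t ρ))) x<t)

  guard : ∀ (t : Term k) ρ s → (s S.< ⟦ S ⟧ (renameᵗ suc t) (s ∷ ρ)) ⇔
    (proj₁ s N.< ⟦ N ⟧ (renameᵗ suc t) (proj₁ s ∷ map proj₁ ρ))
  guard t ρ s = subst-⇔ (proj₁ s N.<_) (⟦⟧-sup (renameᵗ suc t) (s ∷ ρ))

  -- `S` is an initial segment of `N` containing the values of terms at its elements, so a bounded
  -- quantifier ranges over the same elements in both.
  Δ₀-sup : Elementary Δ₀ (sup⊆ N⊨PA⁻ f)
  Δ₀-sup _ (s ≐ t) ρ = subst-⇔ id (cong₂ N._≈_ (⟦⟧-sup s ρ) (⟦⟧-sup t ρ))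
  Δ₀-sup _ (s ≺ t) ρ = subst-⇔ id (cong₂ N._<_ (⟦⟧-sup s ρ) (⟦⟧-sup t ρ))
  Δ₀-sup _ ⊥′      ρ = ⇔-id _
  Δ₀-sup _ (φ ∧ ψ) ρ = Δ₀-sup _ φ ρ ×-⇔ Δ₀-sup _ ψ ρ
  Δ₀-sup _ (φ ∨ ψ) ρ = Δ₀-sup _ φ ρ ⊎-⇔ Δ₀-sup _ ψ ρ
  Δ₀-sup _ (φ ⇒ ψ) ρ = →-cong-⇔ (Δ₀-sup _ φ ρ) (Δ₀-sup _ ψ ρ)
  Δ₀-sup _ (∀< t φ) ρ = mk⇔
    (λ h x x<t → let s = x , below-term t ρ x<t in
      to (Δ₀-sup _ φ (s ∷ ρ)) (h s (from (guard t ρ s) x<t)))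
    (λ h s s<t → from (Δ₀-sup _ φ (s ∷ ρ)) (h (proj₁ s) (to (guard t ρ s) s<t)))
  Δ₀-sup _ (∃< t φ) ρ = mk⇔
    (λ (s , s<t , h) → proj₁ s , to (guard t ρ s) s<t , to (Δ₀-sup _ φ (s ∷ ρ)) h)
    (λ (x , x<t , h) → let s = x , below-term t ρ x<t in
      s , from (guard t ρ s) x<t , from (Δ₀-sup _ φ (s ∷ ρ)) h)

  module _ (em : ExcludedMiddle ℓ) where
    private
      module SM = Semantics M
      module SN = Semantics N
      module SS = Semantics S

    restrict : ∀ {m} (y : Vec N.Carrier m) v → y SN.<* map ι v →
      Σ[ s ∈ Vec S.Carrier m ] map proj₁ s ≡ y
    restrict []      []      _   = [] , refl
    restrict (y ∷ ys) (v ∷ vs) y<v =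
      let s , s≡ = restrict ys vs (y<v ∘ suc)
      in (y , v , inj₁ (y<v zero)) ∷ s , cong (y ∷_) s≡

    -- `go` climbs through the levels by the Tarski-Vaught test. Given elementarity for the matrix,
    -- it remains to find a witness inside `S`, which `bounded-witness` does.
    sup-elementary : ∀ n → M ⊨ Collₛ (Σₙ (suc n)) →
      (∀ {i} → i ℕ.< n → M ⊨ Coll (Πₙ i)) → (∀ {i} → i ℕ.< n → N ⊨ Coll (Πₙ i)) →
      Elementary (Σₙ (suc n)) f → Elementary (Σₙ (suc n)) (sup⊆ N⊨PA⁻ f)
    sup-elementary n MCollₛ CM CN f-elem = go (suc n) ≤-refl
      where
      open Transfer em f

      module _ {k m} (ψ : Formula (m ℕ.+ k)) (ψ∈ : Πₙ n ψ) (ρ : Vec S.Carrier k) where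
        -- The parameters ρ need not lie in `M`, so they cannot be the z⃗ of a collection instance
        -- in `M`. They take the place of x⃗ < u⃗ with u⃗ from `M`, and z⃗ is empty; the renaming
        -- only adjusts the context to `k ℕ.+ 0`.
        ψ′ : Formula (m ℕ.+ (k ℕ.+ 0))
        ψ′ = rename (lift m (_↑ˡ 0)) ψ

        ψ′∈ : Πₙ n ψ′
        ψ′∈ = Π-rename n _ ψ∈

        u : Vec M.Carrier k
        u = map strictBound ρ

        ρ<u : map proj₁ ρ SN.<* map ι u
        ρ<u i = subst₂ N._<_ (sym (lookup-map i proj₁ ρ))
          (sym (trans (lookup-map i ι u) (cong ι (lookup-map i strictBound ρ))))
          (<strictBound (lookup ρ i))

        bound-in-M : Σ[ v ∈ Vec M.Carrier m ]
          M ⊨ strongCollectionBody {m} {k} {0} ψ′ [ v ++ (u ++ []) ]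
        bound-in-M =
          let v , h = to (SM.strongCollection-⊨ {k} {m} {0} ψ′)
                        (MCollₛ _ (collₛ {p = k} {m} {0} (Π⊆Σ-suc n ψ′∈))) u []
          in v , from (SM.strongCollectionBody-⊨ {k} {m} {0} ψ′ v u []) h

        bounded-witness : ∀ (ys : Vec N.Carrier m) → N ⊨ ψ [ ys ++ map proj₁ ρ ] →
          Σ[ s ∈ Vec S.Carrier m ] N ⊨ ψ [ map proj₁ s ++ map proj₁ ρ ]
        bounded-witness ys ψ⊨ =
          let v , M⊨body = bound-in-M
              -- The images of v⃗ and u⃗ satisfy the body in `N`, where x⃗ may be any tuple of `N`
              -- below u⃗, in particular ρ.
              N⊨body = to (transfer (Π-elementary (suc n) f-elem)
                (Π∋strongCollectionBody n (collectsBelow n CM CN) {k} {m} {0} ψ′∈)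
                (v ++ (u ++ []))) M⊨body
              y , y<v , ψ′⊨ = to (SN.strongCollectionBody-⊨ {k} {m} {0} ψ′ (map ι v) (map ι u) [])
                (subst (N ⊨ strongCollectionBody {m} {k} {0} ψ′ [_])
                  (trans (map-++ ι v (u ++ [])) (cong (map ι v ++_) (map-++ ι u []))) N⊨body)
                (map proj₁ ρ) ρ<u (ys , from (drop-[] ys) ψ⊨)
              s , s≡y = restrict y v y<v
          in s , to (drop-[] (map proj₁ s))
                   (subst (λ y → N ⊨ ψ′ [ y ++ (map proj₁ ρ ++ []) ]) (sym s≡y) ψ′⊨)
          where
          drop-[] : ∀ (y : Vec N.Carrier m) →
            (N ⊨ ψ′ [ y ++ (map proj₁ ρ ++ []) ]) ⇔ (N ⊨ ψ [ y ++ map proj₁ ρ ])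
          drop-[] y = SN.rename-⊨ ψ (reindexes-lift y (reindexes-++ˡ (map proj₁ ρ) []))

      go : ∀ k → k ℕ.≤ suc n → Elementary (Σₙ k) (sup⊆ N⊨PA⁻ f)
      go zero    _         = Δ₀-sup
      go (suc k) (s≤s k≤n) _ (m , ψ , ψ∈ , refl) ρ =
        SS.∃*-⊨ m {φ = ψ} {ρ} ⨾ mk⇔ forth back ⨾ ⇔-sym (SN.∃*-⊨ m {φ = ψ} {map proj₁ ρ})
        where
        ψ-elem : ∀ (s : Vec S.Carrier m) →
          (S ⊨ ψ [ s ++ ρ ]) ⇔ (N ⊨ ψ [ map proj₁ s ++ map proj₁ ρ ])
        ψ-elem s =
          Transfer.Π-elementary em (sup⊆ N⊨PA⁻ f) k (go k (m≤n⇒m≤1+n k≤n)) ψ ψ∈ (s ++ ρ)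
          ⨾ subst-⇔ (N ⊨ ψ [_]) (map-++ proj₁ s ρ)

        forth : ∃[ s ] S ⊨ ψ [ s ++ ρ ] → ∃[ ys ] N ⊨ ψ [ ys ++ map proj₁ ρ ]
        forth (s , ψ⊨) = map proj₁ s , to (ψ-elem s) ψ⊨

        back : ∃[ ys ] N ⊨ ψ [ ys ++ map proj₁ ρ ] → ∃[ s ] S ⊨ ψ [ s ++ ρ ]
        back (ys , ψ⊨) =
          -- A Πₖ matrix is read as Πₙ here, so strong collection is used at the top level for every
          -- k.
          let s , ψ⊨′ = bounded-witness ψ (Π-mono (≤⇒≤′ k≤n) ψ∈) ρ ys ψ⊨
          in s , from (ψ-elem s) ψ⊨′

    -- Elementarity is used twice: to bring ∃ y⃗ φ down to `S`, after merging the existential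
    -- blocks, and to take φ at the witness found there back up to `N`.
    sup-witness : ∀ n → Elementary (Σₙ (suc n)) (sup⊆ N⊨PA⁻ f) →
      {φ : Formula (q ℕ.+ k)} → Σₙ (suc n) φ → ∀ ρ → N ⊨ ∃* q φ [ map proj₁ ρ ] →
      Σ[ y ∈ Vec S.Carrier q ] N ⊨ φ [ map proj₁ (y ++ ρ) ]
    sup-witness {q = q} n S≺N {φ} φ∈ ρ N⊨∃φ =
      let y , φ⊨ = to (SS.∃*-⊨ q {φ = φ} {ρ}) S⊨∃φ in y , to (S≺N φ φ∈ (y ++ ρ)) φ⊨
      where
      open Transfer em (sup⊆ N⊨PA⁻ f)
      S⊨∃φ : S ⊨ ∃* q φ [ ρ ]
      S⊨∃φ = from (transfer S≺N (∃*-Σ n q (∋-refl φ∈)) ρ) N⊨∃φ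

-- The implications

module Equivalences (em : ExcludedMiddle ℓ) (ext : Extensionality ℓ ℓ)
  (M : Structure ℓ) (M⊨PA⁻ : M ⊨ PA⁻ ℓ) where
  private module M = Structure M
  open PA⁻-Properties M⊨PA⁻

  Collₛ⇒CollΠ : ∀ n → M ⊨ Collₛ (Σₙ (suc n)) → ∀ {i} → i ℕ.< n → M ⊨ Coll (Πₙ i)
  Collₛ⇒CollΠ n MCollₛ i<n = Coll-mono
    (λ φ∈ → Σ-mono (≤⇒≤′ (s≤s (<⇒≤ i<n))) (Π⊆Σ-suc _ φ∈)) (Collₛ⇒Coll MCollₛ)

  CollΣ⇒CollΠ : ∀ {K : Structure ℓ} n → K ⊨ Coll (Σₙ n) → ∀ {i} → i ℕ.< n → K ⊨ Coll (Πₙ i)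
  CollΣ⇒CollΠ n C i<n = Coll-mono (λ φ∈ → Σ-mono (≤⇒≤′ i<n) (Π⊆Σ-suc _ φ∈)) C

  strong⇒collection : ∀ n → M ⊨ Collₛ (Σₙ (suc n)) → CollectionCondition M n
  strong⇒collection zero MCollₛ N N⊨PA⁻ f f-elem =
    Sup.sup-elementary M⊨PA⁻ N⊨PA⁻ f em 0 MCollₛ (λ ()) (λ ()) f-elem
  strong⇒collection n@(suc _) MCollₛ =
    Coll-mono (Σ⊆Σ-suc n) (Collₛ⇒Coll MCollₛ) , λ N N⊨PA⁻ NColl f f-elem →
      Sup.sup-elementary M⊨PA⁻ N⊨PA⁻ f em n
        MCollₛ (Collₛ⇒CollΠ n MCollₛ) (CollΣ⇒CollΠ n NColl) f-elem

  collection⇒Σₙ₊₂ : ∀ n → CollectionCondition M n → Σₙ₊₂Condition M n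
  collection⇒Σₙ₊₂ zero h N N⊨PA⁻ f f-elem = h N N⊨PA⁻ f λ φ φ∈ → f-elem φ (Σ⊆Σ-suc 1 φ∈)
  collection⇒Σₙ₊₂ n@(suc n′) (MColl , h) N N⊨PA⁻ f f-elem =
    h N N⊨PA⁻
      -- The top case i = n′ of the transferred collection already gives `Coll (Σₙ n)` in `N`.
      (CollΠ⇒CollΣ-suc n′ (Transfer.collection-transfer em f n f-elem (CollΣ⇒CollΠ n MColl) (n<1+n n′)))
      f λ φ φ∈ → f-elem φ (Σ⊆Σ-suc (suc n) φ∈)

  Σₙ₊₂⇒elementary : ∀ n → Σₙ₊₂Condition M n → ElementaryCondition M n
  Σₙ₊₂⇒elementary n h N N⊨PA⁻ f f-elem = h N N⊨PA⁻ f λ φ _ → f-elem φ _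

  module _ {q : ℕ} where
    open Semantics M

    infix 4 _≲_
    -- Defined by inclusion of the strict lower sets: the form in which a failure at a larger bound
    -- is contradicted by a witness below a smaller one.
    record _≲_ (v w : Vec M.Carrier q) : Set ℓ where
      constructor dominated
      field <*-mono : ∀ y → y <* v → y <* w
    open _≲_ public

    ≲-refl : Reflexive _≲_
    ≲-refl = dominated λ _ → id

    ≲-trans : Transitive _≲_
    ≲-trans v≲w w≲x = dominated λ y → <*-mono w≲x y ∘ <*-mono v≲w y

    upperBound : ∀ x y → ∃[ z ] (x M.≤ z × y M.≤ z)
    upperBound x y with <-total x y
    ... | inj₁ x≤y = y , x≤y , inj₂ M.refl
    ... | inj₂ y<x = x , inj₂ M.refl , inj₁ y<x

    ≲-directed : ∀ v w → ∃[ z ] (v ≲ z × w ≲ z)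
    ≲-directed v w = z
      , dominated (λ y y<v i → subst (_ M.<_) (sym (z≡ i))
          (<-≤-trans (y<v i) (proj₁ (proj₂ (bound i)))))
      , dominated (λ y y<w i → subst (_ M.<_) (sym (z≡ i))
          (<-≤-trans (y<w i) (proj₂ (proj₂ (bound i)))))
      where
      bound : ∀ i → ∃[ z ] (lookup v i M.≤ z × lookup w i M.≤ z)
      bound i = upperBound (lookup v i) (lookup w i)
      z : Vec M.Carrier q
      z = tabulate (proj₁ ∘ bound)
      z≡ : ∀ i → lookup z i ≡ proj₁ (bound i)
      z≡ = lookup∘tabulate (proj₁ ∘ bound)

  module Counterexample {p q r} (φ : Formula (q ℕ.+ (p ℕ.+ r)))
    (u : Vec M.Carrier p) (z : Vec M.Carrier r) where
    private
      module SM = Semantics M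
      I : Set ℓ
      I = Vec M.Carrier q

    Unbounded : I → Set ℓ
    Unbounded v = Σ[ x ∈ Vec M.Carrier p ] (x SM.<* u × (Σ[ y ∈ I ] M ⊨ φ [ y ++ (x ++ z) ]) ×
      ¬ (Σ[ y ∈ I ] (y SM.<* v × M ⊨ φ [ y ++ (x ++ z) ])))

    module _ (unbounded : ∀ v → Unbounded v) where
      private
        𝒰 : Ultrafilter I
        𝒰 = tail-ultrafilter em ext _≲_ ≲-refl ≲-trans ≲-directed (replicate q M.0#)

        tails : ∀ w → Ultrafilter.Large 𝒰 (w ≲_)
        tails = tails-large em ext _≲_ ≲-refl ≲-trans ≲-directed (replicate q M.0#)

      open Ultrafilter 𝒰
      open Ultrapower em M 𝒰 renaming (ultrapower to N)

      -- Opaque because `S` is built from this proof, whose unfolding would only burden type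
      -- checking.
      abstract
        N⊨PA⁻ : N ⊨ PA⁻ ℓ
        N⊨PA⁻ σ σ∈ = to (diagonal-elementary σ _ []) (M⊨PA⁻ σ σ∈)

      open Sup M⊨PA⁻ N⊨PA⁻ diagonal using (S; strictBound; <strictBound; sup-witness)
      private module S = Structure S

      x : I → Vec M.Carrier p
      x v = proj₁ (unbounded v)

      -- The classes of the coordinates of the counterexamples, placed in `S` by the diagonal image
      -- of `u`.
      xˢ : Vec S.Carrier p
      xˢ = tabulate λ i → (λ v → lookup (x v) i) , lookup u i ,
        inj₁ (large-all λ v → proj₁ (proj₂ (unbounded v)) i)

      zˢ : Vec S.Carrier r
      zˢ = map (λ a → const a , a , inj₂ (large-all λ _ → M.refl)) z

      ρ : Vec S.Carrier (p ℕ.+ r)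
      ρ = xˢ ++ zˢ

      eval-ρ : ∀ v → eval v (map proj₁ ρ) ≡ x v ++ z
      eval-ρ v = begin
        eval v (map proj₁ ρ)                  ≡⟨ map-∘ (λ f → f v) proj₁ ρ ⟨
        map (λ s → proj₁ s v) (xˢ ++ zˢ)      ≡⟨ map-++ (λ s → proj₁ s v) xˢ zˢ ⟩
        map (λ s → proj₁ s v) xˢ ++ map (λ s → proj₁ s v) zˢ
          ≡⟨ cong₂ _++_ (sym (tabulate-∘ (λ s → proj₁ s v) _))
                        (sym (map-∘ (λ s → proj₁ s v) _ z)) ⟩
        tabulate (lookup (x v)) ++ map id z   ≡⟨ cong₂ _++_ (tabulate∘lookup (x v)) (map-id z) ⟩
        x v ++ z                              ∎
        where open ≡-Reasoning

      N⊨∃φ : N ⊨ ∃* q φ [ map proj₁ ρ ]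
      N⊨∃φ = from (łoś (∃* q φ) (map proj₁ ρ)) (large-all λ v →
        subst (M ⊨ ∃* q φ [_]) (sym (eval-ρ v))
          (from (SM.∃*-⊨ q) (proj₁ (proj₂ (proj₂ (unbounded v))))))

      -- A witness y in `S` lies below the diagonal image of some w in `M`. On a large set of v, φ
      -- holds of the value of y at v, this value is below w, and w ≲ v; so it is a witness below v,
      -- against the choice of `x v`.
      no-witness : ¬ (Σ[ y ∈ Vec S.Carrier q ] N ⊨ φ [ map proj₁ (y ++ ρ) ])
      no-witness (y , φ⊨) =
        let v , (φ⊨v , y<w) , w≲v = large-∃ (large-× (large-× φ-large y<w-large) (tails w))
        in proj₂ (proj₂ (proj₂ (unbounded v)))
             (eval v (map proj₁ y) , <*-mono w≲v (eval v (map proj₁ y)) y<w , φ⊨v)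
        where
        w : I
        w = map strictBound y

        φ-large : Large (λ v → M ⊨ φ [ eval v (map proj₁ y) ++ (x v ++ z) ])
        φ-large = large-mono
          (λ v → subst (M ⊨ φ [_]) (trans
            (cong (eval v) (map-++ proj₁ y ρ))
            (trans (map-++ _ (map proj₁ y) (map proj₁ ρ))
              (cong (eval v (map proj₁ y) ++_) (eval-ρ v)))))
          (to (łoś φ (map proj₁ (y ++ ρ))) φ⊨)

        y<w-large : Large (λ v → eval v (map proj₁ y) SM.<* w)
        y<w-large = large-∀-Fin q λ j → large-mono
          (λ v → subst₂ M._<_
            (sym (trans (lookup-map j _ (map proj₁ y)) (cong (λ f → f v) (lookup-map j proj₁ y))))
            (sym (lookup-map j strictBound y)))
          (<strictBound (lookup y j))

      refute : ∀ {n} → Σₙ (suc n) φ → ¬ ElementaryCondition M n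
      refute {n} φ∈ h = no-witness
        (sup-witness em n (h N N⊨PA⁻ diagonal diagonal-elementary) φ∈ ρ N⊨∃φ)

  elementary⇒strong : ∀ n → ElementaryCondition M n → M ⊨ Collₛ (Σₙ (suc n))
  elementary⇒strong n h σ (collₛ {p} {q} {r} {φ} φ∈) =
    from (Semantics.strongCollection-⊨ M {p} {q} {r} φ) λ u z →
      decidable-stable em λ ¬bounded → Counterexample.refute {p} {q} {r} φ u z
        (λ v → decidable-stable em λ ¬unbounded → ¬bounded (v , λ x x<u ∃y →
          decidable-stable em λ ¬∃y<v → ¬unbounded (x , x<u , ∃y , ¬∃y<v)))
        φ∈ h

theorem3p1 : ∀ {ℓ} → ExcludedMiddle ℓ → Extensionality ℓ ℓ →
    (M : Structure ℓ) → M ⊨ PA⁻ ℓ → (n : ℕ) →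
    (ElementaryCondition M n ⇔ (M ⊨ Collₛ (Σₙ (suc n)))) ×
    ((M ⊨ Collₛ (Σₙ (suc n))) ⇔ CollectionCondition M n) ×
    (CollectionCondition M n ⇔ Σₙ₊₂Condition M n)
theorem3p1 em ext M M⊨PA⁻ n =
    mk⇔ 1⇒2 (4⇒1 ∘ 3⇒4 ∘ 2⇒3)
  , mk⇔ 2⇒3 (1⇒2 ∘ 4⇒1 ∘ 3⇒4)
  , mk⇔ 3⇒4 (2⇒3 ∘ 1⇒2 ∘ 4⇒1)
  where
  open Equivalences em ext M M⊨PA⁻
  1⇒2 = elementary⇒strong n
  2⇒3 = strong⇒collection n
  3⇒4 = collection⇒Σₙ₊₂ n
  4⇒1 = Σₙ₊₂⇒elementary n
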